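{- For every $k\in\mathbb Z$, $\mathcal A=\mathbb Z[\mathbb P][x_{k-1},x_k,x_{k+1},x_{k+2}]$.
   Context: Fix positive integers $\ell_1,\ell_2$ and independent variables $p_{i,k}$ ($i=1,2$, $1\le k\le\ell_i$), $p_{i,0}=1$. Let $\mathbb P$ be the group of Laurent monomials in the $p_{i,k}$ and $\mathbb Z[\mathbb P]$ its group ring; let $\mathcal F=\mathbb Q(p_{i,k})(x_1,x_2)$ with $x_1,x_2$ independent. Put $P_1(z)=1+\sum_{k=1}^{\ell_1}p_{1,k}z^k$, $P_2(z)=1+\sum_{k=1}^{\ell_2}p_{2,k}z^k$ and $\overline P_i(z)=z^{\ell_i}P_i(z^{ -1})/p_{i,\ell_i}$. Define $x_k\in\mathcal F$ for all $k\in\mathbb Z$ from $x_1,x_2$ by $x_{k+1}x_{k-1}=P_1(x_k)$ if $k\equiv1$, $P_2(x_k)$ if $k\equiv2$, $\overline P_1(x_k)$ if $k\equiv3$, $\overline P_2(x_k)$ if $k\equiv0\pmod4$. Let $\mathcal A$ be the $\mathbb Z[\mathbb P]$-subalgebra of $\mathcal F$ generated by all $x_k$. -}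

module Defs where

open import Algebra.Bundles using (CommutativeRing)
import Algebra.Properties.CommutativeMonoid.Sum as FiniteSum
import Algebra.Properties.Ring as RingProperties
import Algebra.Properties.Semiring.Exp as Exponentiation
import Algebra.Properties.Semiring.Mult as Multiples
import Algebra.Solver.Ring.NaturalCoefficients.Default as SemiringSolver
open import Data.Empty using (⊥-elim)
open import Data.Fin.Base using (Fin; zero; suc; toℕ; fromℕ; _↑ˡ_; _↑ʳ_)
open import Data.Integer.Base as ℤ using (ℤ; +_; +[1+_]; -[1+_]; 1ℤ; _%ℕ_)
import Data.Integer.Properties as ℤₚ
open import Data.List.Base using (List; []; _∷_; foldr; map)
open import Data.Nat.Base using (ℕ; zero; suc; _+_)
open import Data.Product.Base using (_×_; _,_; ∃-syntax; proj₁; proj₂)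
open import Data.Rational.Base as ℚ using (ℚ; 0ℚ; 1ℚ)
import Data.Rational.Properties as ℚₚ
open import Data.Sum.Base using (_⊎_; inj₁; inj₂)
open import Data.Vec.Functional using (Vector)
open import Level using (0ℓ)
open import Relation.Binary.Bundles using (Setoid)
open import Relation.Binary.Definitions using (Decidable)
open import Relation.Binary.PropositionalEquality as ≡ using (_≡_)
import Relation.Binary.Reasoning.Setoid as SetoidReasoning
open import Relation.Binary.Structures using (IsEquivalence)
open import Relation.Nullary.Decidable using (Dec; yes; no; map′)
open import Relation.Nullary.Negation using (¬_)
open import Relation.Unary using (Pred)

record IntegralDomain : Set₁ where
  field
    commutativeRing : CommutativeRing 0ℓ 0ℓ

  open CommutativeRing commutativeRing public

  field
    _≟_          : Decidable _≈_
    1≉0          : ¬ (1# ≈ 0#)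
    zero-product : ∀ {a b} → a * b ≈ 0# → a ≈ 0# ⊎ b ≈ 0#

  open RingProperties ring public using (x[y-z]≈xy-xz; x∙y⁻¹≈ε⇒x≈y)

  *-nonzero : ∀ {a b} → ¬ (a ≈ 0#) → ¬ (b ≈ 0#) → ¬ (a * b ≈ 0#)
  *-nonzero a≉0 b≉0 ab≈0 with zero-product ab≈0
  ... | inj₁ a≈0 = a≉0 a≈0
  ... | inj₂ b≈0 = b≉0 b≈0

  *-cancelˡ-nonzero : ∀ {a b c} → ¬ (a ≈ 0#) → a * b ≈ a * c → b ≈ c
  *-cancelˡ-nonzero {a} {b} {c} a≉0 ab≈ac with zero-product {a} {b - c}
    (trans (x[y-z]≈xy-xz a b c) (trans (+-congʳ ab≈ac) (-‿inverseʳ (a * c))))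
  ... | inj₁ a≈0   = ⊥-elim (a≉0 a≈0)
  ... | inj₂ b-c≈0 = x∙y⁻¹≈ε⇒x≈y b c b-c≈0

-- The inverse is a total operation with the convention 0⁻¹ = 0.
record DiscreteField : Set₁ where
  field
    integralDomain : IntegralDomain

  open IntegralDomain integralDomain public

  infix 9 _⁻¹

  field
    _⁻¹         : Carrier → Carrier
    ⁻¹-inverseʳ : ∀ {a} → ¬ (a ≈ 0#) → a * a ⁻¹ ≈ 1#
    0⁻¹≈0       : ∀ {a} → a ≈ 0# → a ⁻¹ ≈ 0#

ℚ-domain : IntegralDomain
ℚ-domain = record
  { commutativeRing = ℚₚ.+-*-commutativeRing
  ; _≟_             = ℚₚ._≟_
  ; 1≉0             = λ ()
  ; zero-product    = zp
  }
  where
  zp : ∀ {a b} → a ℚ.* b ≡ 0ℚ → a ≡ 0ℚ ⊎ b ≡ 0ℚ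
  zp {a} {b} ab≡0 with a ℚₚ.≟ 0ℚ
  ... | yes a≡0 = inj₁ a≡0
  ... | no  a≢0 = inj₂ (begin
    b                        ≡⟨ ℚₚ.*-identityˡ b ⟨
    1ℚ ℚ.* b                 ≡⟨ ≡.cong (ℚ._* b) (ℚₚ.*-inverseˡ a) ⟨
    (ℚ.1/ a) ℚ.* a ℚ.* b     ≡⟨ ℚₚ.*-assoc (ℚ.1/ a) a b ⟩
    (ℚ.1/ a) ℚ.* (a ℚ.* b)   ≡⟨ ≡.cong ((ℚ.1/ a) ℚ.*_) ab≡0 ⟩
    (ℚ.1/ a) ℚ.* 0ℚ          ≡⟨ ℚₚ.*-zeroʳ (ℚ.1/ a) ⟩
    0ℚ                       ∎)
    where
    open ≡.≡-Reasoning
    instance _ = ℚ.≢-nonZero a≢0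

-- Polynomials in one variable: a₀ ∷ a₁ ∷ … is a₀ + a₁X + ⋯, and lists
-- that differ by trailing zeros are identified.

module Polynomial (D : IntegralDomain) where
  open IntegralDomain D renaming (_+_ to _+ᴰ_)

  Poly : Set
  Poly = List Carrier

  coeff : Poly → ℕ → Carrier
  coeff []      _       = 0#
  coeff (a ∷ p) zero    = a
  coeff (a ∷ p) (suc n) = coeff p n

  infix 4 _≋_
  record _≋_ (p q : Poly) : Set where
    constructor mk
    field at : ∀ n → coeff p n ≈ coeff q n
  open _≋_ public

  infixl 6 _⊕_
  infixl 7 _⊗_ _·_

  _⊕_ : Poly → Poly → Poly
  []      ⊕ q       = q
  (a ∷ p) ⊕ []      = a ∷ p
  (a ∷ p) ⊕ (b ∷ q) = (a +ᴰ b) ∷ (p ⊕ q)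

  ⊖_ : Poly → Poly
  ⊖_ = map (-_)

  _·_ : Carrier → Poly → Poly
  a · p = map (a *_) p

  _⊗_ : Poly → Poly → Poly
  []      ⊗ q = []
  (a ∷ p) ⊗ q = (a · q) ⊕ (0# ∷ (p ⊗ q))

  constant : Carrier → Poly
  constant a = a ∷ []

  X : Poly
  X = 0# ∷ 1# ∷ []

  private
    coeff-⊕ : ∀ p q n → coeff (p ⊕ q) n ≈ coeff p n +ᴰ coeff q n
    coeff-⊕ []      q       n       = sym (+-identityˡ _)
    coeff-⊕ (a ∷ p) []      n       = sym (+-identityʳ _)
    coeff-⊕ (a ∷ p) (b ∷ q) zero    = refl
    coeff-⊕ (a ∷ p) (b ∷ q) (suc n) = coeff-⊕ p q n

    coeff-⊖ : ∀ p n → coeff (⊖ p) n ≈ - coeff p n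
    coeff-⊖ []      n       = sym (RingProperties.-0#≈0# ring)
    coeff-⊖ (a ∷ p) zero    = refl
    coeff-⊖ (a ∷ p) (suc n) = coeff-⊖ p n

    coeff-· : ∀ a p n → coeff (a · p) n ≈ a * coeff p n
    coeff-· a []      n       = sym (zeroʳ a)
    coeff-· a (b ∷ p) zero    = refl
    coeff-· a (b ∷ p) (suc n) = coeff-· a p n

    ≋-refl : ∀ {p} → p ≋ p
    ≋-refl = mk λ n → refl

    ≋-sym : ∀ {p q} → p ≋ q → q ≋ p
    ≋-sym e = mk λ n → sym (at e n)

    ≋-trans : ∀ {p q r} → p ≋ q → q ≋ r → p ≋ r
    ≋-trans e f = mk λ n → trans (at e n) (at f n)

    ≋-isEquivalence : IsEquivalence _≋_
    ≋-isEquivalence = record { refl = ≋-refl ; sym = ≋-sym ; trans = ≋-trans }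

    ≋-setoid : Setoid 0ℓ 0ℓ
    ≋-setoid = record { isEquivalence = ≋-isEquivalence }

    open SetoidReasoning ≋-setoid

    ∷-cong : ∀ {a b p q} → a ≈ b → p ≋ q → (a ∷ p) ≋ (b ∷ q)
    ∷-cong a≈b p≋q = mk λ { zero → a≈b ; (suc n) → at p≋q n }

    tail-cong : ∀ {a b p q} → (a ∷ p) ≋ (b ∷ q) → p ≋ q
    tail-cong e = mk λ n → at e (suc n)

    0∷[]≋[] : (0# ∷ []) ≋ []
    0∷[]≋[] = mk λ { zero → refl ; (suc n) → refl }

    ⊕-cong : ∀ {p p′ q q′} → p ≋ p′ → q ≋ q′ → (p ⊕ q) ≋ (p′ ⊕ q′)
    ⊕-cong {p} {p′} {q} {q′} e f = mk λ n →
      trans (coeff-⊕ p q n)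
        (trans (+-cong (at e n) (at f n)) (sym (coeff-⊕ p′ q′ n)))

    ⊕-congˡ : ∀ p {q q′} → q ≋ q′ → (p ⊕ q) ≋ (p ⊕ q′)
    ⊕-congˡ p = ⊕-cong {p} ≋-refl

    ⊕-comm : ∀ p q → (p ⊕ q) ≋ (q ⊕ p)
    ⊕-comm p q = mk λ n →
      trans (coeff-⊕ p q n) (trans (+-comm _ _) (sym (coeff-⊕ q p n)))

    ⊕-assoc : ∀ p q r → ((p ⊕ q) ⊕ r) ≋ (p ⊕ (q ⊕ r))
    ⊕-assoc p q r = mk λ n →
      trans (coeff-⊕ (p ⊕ q) r n)
        (trans (+-congʳ (coeff-⊕ p q n))
          (trans (+-assoc _ _ _)
            (sym (trans (coeff-⊕ p (q ⊕ r) n) (+-congˡ (coeff-⊕ q r n))))))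

    ⊕-identityʳ : ∀ p → (p ⊕ []) ≋ p
    ⊕-identityʳ p = mk λ n → trans (coeff-⊕ p [] n) (+-identityʳ _)

    ⊖-cong : ∀ {p q} → p ≋ q → (⊖ p) ≋ (⊖ q)
    ⊖-cong {p} {q} e = mk λ n →
      trans (coeff-⊖ p n) (trans (-‿cong (at e n)) (sym (coeff-⊖ q n)))

    ⊖-inverseʳ : ∀ p → (p ⊕ (⊖ p)) ≋ []
    ⊖-inverseʳ p = mk λ n →
      trans (coeff-⊕ p (⊖ p) n) (trans (+-congˡ (coeff-⊖ p n)) (-‿inverseʳ _))

    ⊕-swap : ∀ p q r → (p ⊕ (q ⊕ r)) ≋ (q ⊕ (p ⊕ r))
    ⊕-swap p q r = begin
      p ⊕ (q ⊕ r) ≈⟨ ⊕-assoc p q r ⟨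
      (p ⊕ q) ⊕ r ≈⟨ ⊕-cong (⊕-comm p q) ≋-refl ⟩
      (q ⊕ p) ⊕ r ≈⟨ ⊕-assoc q p r ⟩
      q ⊕ (p ⊕ r) ∎

    ⊕-medial : ∀ p q r s → ((p ⊕ q) ⊕ (r ⊕ s)) ≋ ((p ⊕ r) ⊕ (q ⊕ s))
    ⊕-medial p q r s = begin
      (p ⊕ q) ⊕ (r ⊕ s) ≈⟨ ⊕-assoc p q (r ⊕ s) ⟩
      p ⊕ (q ⊕ (r ⊕ s)) ≈⟨ ⊕-congˡ p (⊕-swap q r s) ⟩
      p ⊕ (r ⊕ (q ⊕ s)) ≈⟨ ⊕-assoc p r (q ⊕ s) ⟨
      (p ⊕ r) ⊕ (q ⊕ s) ∎

    shift-⊕ : ∀ p q → (0# ∷ (p ⊕ q)) ≋ ((0# ∷ p) ⊕ (0# ∷ q))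
    shift-⊕ p q = ∷-cong (sym (+-identityˡ 0#)) ≋-refl

    ·-congˡ : ∀ a {p q} → p ≋ q → (a · p) ≋ (a · q)
    ·-congˡ a {p} {q} e = mk λ n →
      trans (coeff-· a p n) (trans (*-congˡ (at e n)) (sym (coeff-· a q n)))

    ·-zero : ∀ {a} p → a ≈ 0# → (a · p) ≋ []
    ·-zero {a} p a≈0 = mk λ n →
      trans (coeff-· a p n) (trans (*-congʳ a≈0) (zeroˡ _))

    ·-identity : ∀ p → (1# · p) ≋ p
    ·-identity p = mk λ n → trans (coeff-· 1# p n) (*-identityˡ _)

    ·-distrib : ∀ a p q → (a · (p ⊕ q)) ≋ ((a · p) ⊕ (a · q))
    ·-distrib a p q = mk λ n →
      trans (coeff-· a (p ⊕ q) n)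
        (trans (*-congˡ (coeff-⊕ p q n))
          (trans (distribˡ _ _ _)
            (sym (trans (coeff-⊕ (a · p) (a · q) n)
                        (+-cong (coeff-· a p n) (coeff-· a q n))))))

    ·-assoc : ∀ a b p → ((a * b) · p) ≋ (a · (b · p))
    ·-assoc a b p = mk λ n →
      trans (coeff-· (a * b) p n)
        (trans (*-assoc _ _ _)
          (sym (trans (coeff-· a (b · p) n) (*-congˡ (coeff-· b p n)))))

    zero-shift-⊗ : ∀ {a} p q → a ≈ 0# → ((a ∷ p) ⊗ q) ≋ (0# ∷ (p ⊗ q))
    zero-shift-⊗ p q a≈0 = ⊕-cong (·-zero q a≈0) ≋-refl

    ⊗-congˡ : ∀ p {q r} → q ≋ r → (p ⊗ q) ≋ (p ⊗ r)
    ⊗-congˡ []      e = ≋-refl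
    ⊗-congˡ (a ∷ p) e = ⊕-cong (·-congˡ a e) (∷-cong refl (⊗-congˡ p e))

    ⊗-zeroʳ : ∀ p → (p ⊗ []) ≋ []
    ⊗-zeroʳ []      = ≋-refl
    ⊗-zeroʳ (a ∷ p) = ≋-trans (∷-cong refl (⊗-zeroʳ p)) 0∷[]≋[]

    ⊗-∷ʳ : ∀ p b q → (p ⊗ (b ∷ q)) ≋ ((b · p) ⊕ (0# ∷ (p ⊗ q)))
    ⊗-∷ʳ []      b q = ≋-sym 0∷[]≋[]
    ⊗-∷ʳ (a ∷ p) b q = ∷-cong (+-congʳ (*-comm a b)) (begin
      (a · q) ⊕ (p ⊗ (b ∷ q))
        ≈⟨ ⊕-congˡ (a · q) (⊗-∷ʳ p b q) ⟩
      (a · q) ⊕ ((b · p) ⊕ (0# ∷ (p ⊗ q)))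
        ≈⟨ ⊕-swap (a · q) (b · p) (0# ∷ (p ⊗ q)) ⟩
      (b · p) ⊕ ((a · q) ⊕ (0# ∷ (p ⊗ q)))
        ∎)

    ⊗-comm : ∀ p q → (p ⊗ q) ≋ (q ⊗ p)
    ⊗-comm []      q = ≋-sym (⊗-zeroʳ q)
    ⊗-comm (a ∷ p) q = begin
      (a · q) ⊕ (0# ∷ (p ⊗ q)) ≈⟨ ⊕-congˡ (a · q) (∷-cong refl (⊗-comm p q)) ⟩
      (a · q) ⊕ (0# ∷ (q ⊗ p)) ≈⟨ ⊗-∷ʳ q a p ⟨
      q ⊗ (a ∷ p)              ∎

    ⊗-cong : ∀ {p p′ q q′} → p ≋ p′ → q ≋ q′ → (p ⊗ q) ≋ (p′ ⊗ q′)
    ⊗-cong {p} {p′} {q} {q′} e f = begin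
      p ⊗ q   ≈⟨ ⊗-congˡ p f ⟩
      p ⊗ q′  ≈⟨ ⊗-comm p q′ ⟩
      q′ ⊗ p  ≈⟨ ⊗-congˡ q′ e ⟩
      q′ ⊗ p′ ≈⟨ ⊗-comm q′ p′ ⟩
      p′ ⊗ q′ ∎

    ⊗-distribˡ : ∀ p q r → (p ⊗ (q ⊕ r)) ≋ ((p ⊗ q) ⊕ (p ⊗ r))
    ⊗-distribˡ []      q r = ≋-refl
    ⊗-distribˡ (a ∷ p) q r = begin
      (a · (q ⊕ r)) ⊕ (0# ∷ (p ⊗ (q ⊕ r)))
        ≈⟨ ⊕-cong (·-distrib a q r) (∷-cong refl (⊗-distribˡ p q r)) ⟩
      ((a · q) ⊕ (a · r)) ⊕ (0# ∷ ((p ⊗ q) ⊕ (p ⊗ r)))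
        ≈⟨ ⊕-congˡ ((a · q) ⊕ (a · r)) (shift-⊕ (p ⊗ q) (p ⊗ r)) ⟩
      ((a · q) ⊕ (a · r)) ⊕ ((0# ∷ (p ⊗ q)) ⊕ (0# ∷ (p ⊗ r)))
        ≈⟨ ⊕-medial (a · q) (a · r) (0# ∷ (p ⊗ q)) (0# ∷ (p ⊗ r)) ⟩
      ((a ∷ p) ⊗ q) ⊕ ((a ∷ p) ⊗ r)
        ∎

    ⊗-distribʳ : ∀ p q r → ((q ⊕ r) ⊗ p) ≋ ((q ⊗ p) ⊕ (r ⊗ p))
    ⊗-distribʳ p q r = begin
      (q ⊕ r) ⊗ p       ≈⟨ ⊗-comm (q ⊕ r) p ⟩
      p ⊗ (q ⊕ r)       ≈⟨ ⊗-distribˡ p q r ⟩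
      (p ⊗ q) ⊕ (p ⊗ r) ≈⟨ ⊕-cong (⊗-comm p q) (⊗-comm p r) ⟩
      (q ⊗ p) ⊕ (r ⊗ p) ∎

    ·-⊗-assoc : ∀ a p q → ((a · p) ⊗ q) ≋ (a · (p ⊗ q))
    ·-⊗-assoc a []      q = ≋-refl
    ·-⊗-assoc a (b ∷ p) q = begin
      ((a * b) · q) ⊕ (0# ∷ ((a · p) ⊗ q))
        ≈⟨ ⊕-cong (·-assoc a b q) (∷-cong (sym (zeroʳ a)) (·-⊗-assoc a p q)) ⟩
      (a · (b · q)) ⊕ (a · (0# ∷ (p ⊗ q)))
        ≈⟨ ·-distrib a (b · q) (0# ∷ (p ⊗ q)) ⟨
      a · ((b ∷ p) ⊗ q)
        ∎

    ⊗-assoc : ∀ p q r → ((p ⊗ q) ⊗ r) ≋ (p ⊗ (q ⊗ r))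
    ⊗-assoc []      q r = ≋-refl
    ⊗-assoc (a ∷ p) q r = begin
      ((a · q) ⊕ (0# ∷ (p ⊗ q))) ⊗ r
        ≈⟨ ⊗-distribʳ r (a · q) (0# ∷ (p ⊗ q)) ⟩
      ((a · q) ⊗ r) ⊕ ((0# ∷ (p ⊗ q)) ⊗ r)
        ≈⟨ ⊕-cong (·-⊗-assoc a q r) (zero-shift-⊗ (p ⊗ q) r refl) ⟩
      (a · (q ⊗ r)) ⊕ (0# ∷ ((p ⊗ q) ⊗ r))
        ≈⟨ ⊕-congˡ (a · (q ⊗ r)) (∷-cong refl (⊗-assoc p q r)) ⟩
      (a ∷ p) ⊗ (q ⊗ r)
        ∎

    ⊗-identityˡ : ∀ p → ((1# ∷ []) ⊗ p) ≋ p
    ⊗-identityˡ p = begin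
      (1# · p) ⊕ (0# ∷ []) ≈⟨ ⊕-cong (·-identity p) 0∷[]≋[] ⟩
      p ⊕ []               ≈⟨ ⊕-identityʳ p ⟩
      p                    ∎

    isZero? : ∀ p → Dec (p ≋ [])
    isZero? []      = yes ≋-refl
    isZero? (a ∷ p) with a ≟ 0# | isZero? p
    ... | no a≉0  | _       = no λ e → a≉0 (at e 0)
    ... | yes _   | no p≉0  = no λ e → p≉0 (mk λ n → at e (suc n))
    ... | yes a≈0 | yes p≋0 = yes (≋-trans (∷-cong a≈0 p≋0) 0∷[]≋[])

    zero-product-∷ : ∀ {a} p → ¬ (a ≈ 0#) → ∀ q → ((a ∷ p) ⊗ q) ≋ [] → q ≋ []
    zero-product-∷ p a≉0 []      _ = ≋-refl
    zero-product-∷ {a} p a≉0 (b ∷ q) e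
      with zero-product (trans (sym (+-identityʳ (a * b))) (at e 0))
    ... | inj₁ a≈0 = ⊥-elim (a≉0 a≈0)
    ... | inj₂ b≈0 = ≋-trans (∷-cong b≈0 q≋0) 0∷[]≋[]
      where
      shifted : (0# ∷ ((a ∷ p) ⊗ q)) ≋ (0# ∷ [])
      shifted = begin
        0# ∷ ((a ∷ p) ⊗ q)                       ≈⟨ ⊕-cong (·-zero (a ∷ p) b≈0) ≋-refl ⟨
        (b · (a ∷ p)) ⊕ (0# ∷ ((a ∷ p) ⊗ q))     ≈⟨ ⊗-∷ʳ (a ∷ p) b q ⟨
        (a ∷ p) ⊗ (b ∷ q)                        ≈⟨ e ⟩
        []                                       ≈⟨ 0∷[]≋[] ⟨
        0# ∷ []                                  ∎
      q≋0 : q ≋ []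
      q≋0 = zero-product-∷ p a≉0 q (tail-cong shifted)

    zero-product-Poly : ∀ p q → (p ⊗ q) ≋ [] → p ≋ [] ⊎ q ≋ []
    zero-product-Poly []      q e = inj₁ ≋-refl
    zero-product-Poly (a ∷ p) q e with a ≟ 0#
    ... | no  a≉0 = inj₂ (zero-product-∷ p a≉0 q e)
    ... | yes a≈0 with zero-product-Poly p q (tail-cong
            (≋-trans (≋-sym (zero-shift-⊗ p q a≈0)) (≋-trans e (≋-sym 0∷[]≋[]))))
    ...   | inj₁ p≋0 = inj₁ (≋-trans (∷-cong a≈0 p≋0) 0∷[]≋[])
    ...   | inj₂ q≋0 = inj₂ q≋0

  polyRing : CommutativeRing 0ℓ 0ℓ
  polyRing = record
    { Carrier = Poly
    ; _≈_     = _≋_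
    ; _+_     = _⊕_
    ; _*_     = _⊗_
    ; -_      = ⊖_
    ; 0#      = []
    ; 1#      = constant 1#
    ; isCommutativeRing = record
      { isRing = record
        { +-isAbelianGroup = record
          { isGroup = record
            { isMonoid = record
              { isSemigroup = record
                { isMagma = record
                  { isEquivalence = ≋-isEquivalence ; ∙-cong = ⊕-cong }
                ; assoc = ⊕-assoc }
              ; identity = (λ p → ≋-refl) , ⊕-identityʳ }
            ; inverse = (λ p → ≋-trans (⊕-comm (⊖ p) p) (⊖-inverseʳ p)) , ⊖-inverseʳ
            ; ⁻¹-cong = ⊖-cong }
          ; comm = ⊕-comm }
        ; *-cong     = ⊗-cong
        ; *-assoc    = ⊗-assoc
        ; *-identity = ⊗-identityˡ , λ p → ≋-trans (⊗-comm p (constant 1#)) (⊗-identityˡ p)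
        ; distrib    = ⊗-distribˡ , ⊗-distribʳ }
      ; *-comm = ⊗-comm }
    }

  polyDomain : IntegralDomain
  polyDomain = record
    { commutativeRing = polyRing
    ; _≟_ = λ p q → map′
        (RingProperties.x∙y⁻¹≈ε⇒x≈y (CommutativeRing.ring polyRing) p q)
        (λ e → ≋-trans (⊕-cong e ≋-refl) (⊖-inverseʳ q))
        (isZero? (p ⊕ (⊖ q)))
    ; 1≉0 = λ e → 1≉0 (at e 0)
    ; zero-product = λ {p} {q} → zero-product-Poly p q
    }

  at1 : Poly → Carrier
  at1 = foldr _+ᴰ_ 0#

  private
    open SemiringSolver commutativeSemiring using (solve; _:+_; _:*_; _:=_)

    at1-zero : ∀ p → p ≋ [] → at1 p ≈ 0#
    at1-zero []      e = refl
    at1-zero (a ∷ p) e =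
      trans (+-cong (at e 0) (at1-zero p (mk λ n → at e (suc n)))) (+-identityˡ 0#)

    at1-cong : ∀ p q → p ≋ q → at1 p ≈ at1 q
    at1-cong []      q       e = sym (at1-zero q (≋-sym e))
    at1-cong (a ∷ p) []      e = at1-zero (a ∷ p) e
    at1-cong (a ∷ p) (b ∷ q) e = +-cong (at e 0) (at1-cong p q (tail-cong e))

    at1-⊕ : ∀ p q → at1 (p ⊕ q) ≈ at1 p +ᴰ at1 q
    at1-⊕ []      q       = sym (+-identityˡ _)
    at1-⊕ (a ∷ p) []      = sym (+-identityʳ _)
    at1-⊕ (a ∷ p) (b ∷ q) = trans (+-congˡ (at1-⊕ p q))
      (solve 4 (λ a b p q → (a :+ b) :+ (p :+ q) := (a :+ p) :+ (b :+ q))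
        refl a b (at1 p) (at1 q))

    at1-· : ∀ a p → at1 (a · p) ≈ a * at1 p
    at1-· a []      = sym (zeroʳ a)
    at1-· a (b ∷ p) = trans (+-congˡ (at1-· a p)) (sym (distribˡ a b (at1 p)))

    at1-⊗ : ∀ p q → at1 (p ⊗ q) ≈ at1 p * at1 q
    at1-⊗ []      q = sym (zeroˡ _)
    at1-⊗ (a ∷ p) q =
      trans (at1-⊕ (a · q) (0# ∷ (p ⊗ q)))
        (trans (+-cong (at1-· a q) (trans (+-identityˡ _) (at1-⊗ p q)))
          (sym (distribʳ (at1 q) a (at1 p))))

  at1-properties : (∀ p q → p ≋ q → at1 p ≈ at1 q)
                 × (∀ p q → at1 (p ⊕ q) ≈ at1 p +ᴰ at1 q)
                 × (∀ p q → at1 (p ⊗ q) ≈ at1 p * at1 q)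
  at1-properties = at1-cong , at1-⊕ , at1-⊗

MPoly : IntegralDomain → ℕ → IntegralDomain
MPoly D zero    = D
MPoly D (suc n) = Polynomial.polyDomain (MPoly D n)

scalar : ∀ D n → IntegralDomain.Carrier D → IntegralDomain.Carrier (MPoly D n)
scalar D zero    a = a
scalar D (suc n) a = Polynomial.constant (MPoly D n) (scalar D n a)

variable# : ∀ D n → Fin n → IntegralDomain.Carrier (MPoly D n)
variable# D (suc n) zero    = Polynomial.X (MPoly D n)
variable# D (suc n) (suc i) = Polynomial.constant (MPoly D n) (variable# D n i)

module FractionField (D : IntegralDomain) where
  open IntegralDomain D renaming (_+_ to _+ᴰ_)
  open SemiringSolver commutativeSemiring using (solve; _:+_; _:*_; _:=_)

  infix 5 _/_[_]
  record Fraction : Set where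
    constructor _/_[_]
    field
      num     : Carrier
      den     : Carrier
      den≉0   : ¬ (den ≈ 0#)
  open Fraction public

  infix 4 _≃_
  record _≃_ (f g : Fraction) : Set where
    constructor mk
    field cross : num f * den g ≈ num g * den f
  open _≃_ public

  embed : Carrier → Fraction
  embed a = a / 1# [ 1≉0 ]

  infixl 6 _⊞_
  infixl 7 _⊠_

  _⊞_ : Fraction → Fraction → Fraction
  (a / b [ b≉0 ]) ⊞ (c / d [ d≉0 ]) = (a * d +ᴰ c * b) / b * d [ *-nonzero b≉0 d≉0 ]

  _⊠_ : Fraction → Fraction → Fraction
  (a / b [ b≉0 ]) ⊠ (c / d [ d≉0 ]) = (a * c) / b * d [ *-nonzero b≉0 d≉0 ]

  ⊟_ : Fraction → Fraction
  ⊟ (a / b [ b≉0 ]) = (- a) / b [ b≉0 ]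

  recip : Fraction → Fraction
  recip (a / b [ b≉0 ]) with a ≟ 0#
  ... | yes _   = embed 0#
  ... | no  a≉0 = b / a [ a≉0 ]

  private
    open SetoidReasoning setoid

    ≃-refl : ∀ {f} → f ≃ f
    ≃-refl = mk refl

    ≃-trans : ∀ {f g h} → f ≃ g → g ≃ h → f ≃ h
    ≃-trans {a / b [ _ ]} {c / d [ d≉0 ]} {e / f [ _ ]} (mk ad≈cb) (mk cf≈ed) =
      mk (*-cancelˡ-nonzero d≉0 (begin
        d * (a * f)  ≈⟨ solve 3 (λ d a f → d :* (a :* f) := (a :* d) :* f) refl d a f ⟩
        (a * d) * f  ≈⟨ *-congʳ ad≈cb ⟩
        (c * b) * f  ≈⟨ solve 3 (λ c b f → (c :* b) :* f := (c :* f) :* b) refl c b f ⟩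
        (c * f) * b  ≈⟨ *-congʳ cf≈ed ⟩
        (e * d) * b  ≈⟨ solve 3 (λ e d b → (e :* d) :* b := d :* (e :* b)) refl e d b ⟩
        d * (e * b)  ∎))

    ≃-isEquivalence : IsEquivalence _≃_
    ≃-isEquivalence = record
      { refl = ≃-refl ; sym = λ { (mk e) → mk (sym e) } ; trans = ≃-trans }

    ⊞-cong : ∀ {f f′ g g′} → f ≃ f′ → g ≃ g′ → (f ⊞ g) ≃ (f′ ⊞ g′)
    ⊞-cong {a / b [ _ ]} {a′ / b′ [ _ ]} {c / d [ _ ]} {c′ / d′ [ _ ]} (mk e) (mk h) = mk (begin
      (a * d +ᴰ c * b) * (b′ * d′)
        ≈⟨ solve 6 (λ a b c d b′ d′ → (a :* d :+ c :* b) :* (b′ :* d′)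
             := (a :* b′) :* (d :* d′) :+ (c :* d′) :* (b :* b′)) refl a b c d b′ d′ ⟩
      (a * b′) * (d * d′) +ᴰ (c * d′) * (b * b′)
        ≈⟨ +-cong (*-congʳ e) (*-congʳ h) ⟩
      (a′ * b) * (d * d′) +ᴰ (c′ * d) * (b * b′)
        ≈⟨ solve 6 (λ a′ b c′ d b′ d′ → (a′ :* b) :* (d :* d′) :+ (c′ :* d) :* (b :* b′)
             := (a′ :* d′ :+ c′ :* b′) :* (b :* d)) refl a′ b c′ d b′ d′ ⟩
      (a′ * d′ +ᴰ c′ * b′) * (b * d) ∎)

    ⊠-cong : ∀ {f f′ g g′} → f ≃ f′ → g ≃ g′ → (f ⊠ g) ≃ (f′ ⊠ g′)
    ⊠-cong {a / b [ _ ]} {a′ / b′ [ _ ]} {c / d [ _ ]} {c′ / d′ [ _ ]} (mk e) (mk h) = mk (begin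
      (a * c) * (b′ * d′)
        ≈⟨ solve 4 (λ a c b d → (a :* c) :* (b :* d) := (a :* b) :* (c :* d)) refl a c b′ d′ ⟩
      (a * b′) * (c * d′)
        ≈⟨ *-cong e h ⟩
      (a′ * b) * (c′ * d)
        ≈⟨ solve 4 (λ a b c d → (a :* b) :* (c :* d) := (a :* c) :* (b :* d)) refl a′ b c′ d ⟩
      (a′ * c′) * (b * d) ∎)

    ⊟-cong : ∀ {f g} → f ≃ g → (⊟ f) ≃ (⊟ g)
    ⊟-cong {a / b [ _ ]} {c / d [ _ ]} (mk e) = mk (begin
      (- a) * d  ≈⟨ RingProperties.-‿distribˡ-* ring a d ⟨
      - (a * d)  ≈⟨ -‿cong e ⟩
      - (c * b)  ≈⟨ RingProperties.-‿distribˡ-* ring c b ⟩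
      (- c) * b  ∎)

    ⊞-comm : ∀ f g → (f ⊞ g) ≃ (g ⊞ f)
    ⊞-comm (a / b [ _ ]) (c / d [ _ ]) = mk (*-cong (+-comm (a * d) (c * b)) (*-comm d b))

    ⊠-comm : ∀ f g → (f ⊠ g) ≃ (g ⊠ f)
    ⊠-comm (a / b [ _ ]) (c / d [ _ ]) = mk (*-cong (*-comm a c) (*-comm d b))

    ⊞-assoc : ∀ f g h → ((f ⊞ g) ⊞ h) ≃ (f ⊞ (g ⊞ h))
    ⊞-assoc (a / b [ _ ]) (c / d [ _ ]) (e / f [ _ ]) = mk
      (solve 6 (λ a b c d e f →
        ((a :* d :+ c :* b) :* f :+ e :* (b :* d)) :* (b :* (d :* f))
        := (a :* (d :* f) :+ (c :* f :+ e :* d) :* b) :* (b :* d :* f)) refl a b c d e f)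

    ⊠-assoc : ∀ f g h → ((f ⊠ g) ⊠ h) ≃ (f ⊠ (g ⊠ h))
    ⊠-assoc (a / b [ _ ]) (c / d [ _ ]) (e / f [ _ ]) =
      mk (*-cong (*-assoc a c e) (sym (*-assoc b d f)))

    ⊞-identityˡ : ∀ f → (embed 0# ⊞ f) ≃ f
    ⊞-identityˡ (a / b [ _ ]) = mk (begin
      (0# * b +ᴰ a * 1#) * b ≈⟨ *-congʳ (+-congʳ (zeroˡ b)) ⟩
      (0# +ᴰ a * 1#) * b     ≈⟨ *-congʳ (+-identityˡ (a * 1#)) ⟩
      (a * 1#) * b           ≈⟨ *-assoc a 1# b ⟩
      a * (1# * b)           ∎)

    ⊠-identityˡ : ∀ f → (embed 1# ⊠ f) ≃ f
    ⊠-identityˡ (a / b [ _ ]) = mk (begin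
      (1# * a) * b ≈⟨ *-congʳ (*-identityˡ a) ⟩
      a * b        ≈⟨ *-congˡ (*-identityˡ b) ⟨
      a * (1# * b) ∎)

    distribˡ-⊞ : ∀ f g h → (f ⊠ (g ⊞ h)) ≃ ((f ⊠ g) ⊞ (f ⊠ h))
    distribˡ-⊞ (a / b [ _ ]) (c / d [ _ ]) (e / f [ _ ]) = mk
      (solve 6 (λ a b c d e f →
        (a :* (c :* f :+ e :* d)) :* (b :* d :* (b :* f))
        := (a :* c :* (b :* f) :+ a :* e :* (b :* d)) :* (b :* (d :* f))) refl a b c d e f)

    ⊟-inverseʳ : ∀ f → (f ⊞ (⊟ f)) ≃ embed 0#
    ⊟-inverseʳ (a / b [ _ ]) = mk (begin
      (a * b +ᴰ (- a) * b) * 1#  ≈⟨ *-identityʳ _ ⟩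
      a * b +ᴰ (- a) * b         ≈⟨ distribʳ b a (- a) ⟨
      (a - a) * b                ≈⟨ *-congʳ (-‿inverseʳ a) ⟩
      0# * b                     ≈⟨ zeroˡ b ⟩
      0#                         ≈⟨ zeroˡ (b * b) ⟨
      0# * (b * b)               ∎)

    numerator-zero : ∀ f → num f ≈ 0# → f ≃ embed 0#
    numerator-zero (a / b [ _ ]) a≈0 =
      mk (trans (*-identityʳ a) (trans a≈0 (sym (zeroˡ b))))

    zero-numerator : ∀ f → f ≃ embed 0# → num f ≈ 0#
    zero-numerator (a / b [ _ ]) (mk e) =
      trans (sym (*-identityʳ a)) (trans e (zeroˡ b))

    recip-inverse : ∀ f → ¬ (f ≃ embed 0#) → (f ⊠ recip f) ≃ embed 1#
    recip-inverse f@(a / b [ _ ]) f≉0 with a ≟ 0#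
    ... | yes a≈0 = ⊥-elim (f≉0 (numerator-zero f a≈0))
    ... | no  _   = mk (trans (*-identityʳ _) (trans (*-comm a b) (sym (*-identityˡ _))))

    recip-zero : ∀ f → f ≃ embed 0# → recip f ≃ embed 0#
    recip-zero f@(a / b [ _ ]) f≈0 with a ≟ 0#
    ... | yes _   = ≃-refl
    ... | no  a≉0 = ⊥-elim (a≉0 (zero-numerator f f≈0))

  fractionRing : CommutativeRing 0ℓ 0ℓ
  fractionRing = record
    { Carrier = Fraction
    ; _≈_     = _≃_
    ; _+_     = _⊞_
    ; _*_     = _⊠_
    ; -_      = ⊟_
    ; 0#      = embed 0#
    ; 1#      = embed 1#
    ; isCommutativeRing = record
      { isRing = record
        { +-isAbelianGroup = record
          { isGroup = record
            { isMonoid = record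
              { isSemigroup = record
                { isMagma = record
                  { isEquivalence = ≃-isEquivalence ; ∙-cong = ⊞-cong }
                ; assoc = ⊞-assoc }
              ; identity = ⊞-identityˡ , λ f → ≃-trans (⊞-comm f (embed 0#)) (⊞-identityˡ f) }
            ; inverse = (λ f → ≃-trans (⊞-comm (⊟ f) f) (⊟-inverseʳ f)) , ⊟-inverseʳ
            ; ⁻¹-cong = ⊟-cong }
          ; comm = ⊞-comm }
        ; *-cong     = ⊠-cong
        ; *-assoc    = ⊠-assoc
        ; *-identity = ⊠-identityˡ , λ f → ≃-trans (⊠-comm f (embed 1#)) (⊠-identityˡ f)
        ; distrib    = distribˡ-⊞ , λ f g h →
            ≃-trans (⊠-comm (g ⊞ h) f)
              (≃-trans (distribˡ-⊞ f g h) (⊞-cong (⊠-comm f g) (⊠-comm f h))) }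
      ; *-comm = ⊠-comm }
    }

  fractionDomain : IntegralDomain
  fractionDomain = record
    { commutativeRing = fractionRing
    ; _≟_ = λ f g → map′ mk cross ((num f * den g) ≟ (num g * den f))
    ; 1≉0 = λ e → 1≉0 (zero-numerator (embed 1#) e)
    ; zero-product = zp
    }
    where
    zp : ∀ {f g} → (f ⊠ g) ≃ embed 0# → f ≃ embed 0# ⊎ g ≃ embed 0#
    zp {f} {g} e with zero-product (zero-numerator (f ⊠ g) e)
    ... | inj₁ a≈0 = inj₁ (numerator-zero f a≈0)
    ... | inj₂ c≈0 = inj₂ (numerator-zero g c≈0)

  fractionField : DiscreteField
  fractionField = record
    { integralDomain = fractionDomain
    ; _⁻¹            = recip
    ; ⁻¹-inverseʳ    = λ {f} → recip-inverse f
    ; 0⁻¹≈0          = λ {f} → recip-zero f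
    }

-- D(t₀, …, tₙ₋₁), opaque because iterating it unfolds to very large terms.
module RationalFunctions (D : IntegralDomain) (n : ℕ) where
  private module Frac = FractionField (MPoly D n)

  opaque
    rationalFunctions : DiscreteField
    rationalFunctions = Frac.fractionField

  open DiscreteField rationalFunctions public using (Carrier; integralDomain)

  opaque
    unfolding rationalFunctions

    constantFunction : IntegralDomain.Carrier D → Carrier
    constantFunction a = Frac.embed (scalar D n a)

    indeterminate : Fin n → Carrier
    indeterminate i = Frac.embed (variable# D n i)

-- Used only to show that no x k vanishes, so that the convention 0⁻¹ = 0
-- plays no role in the cluster sequence.

record PositiveCone (D : IntegralDomain) : Set₁ where
  open IntegralDomain D renaming (_+_ to _+ᴰ_)
  field
    Pos      : Carrier → Set
    Pos-resp : ∀ {a b} → a ≈ b → Pos a → Pos b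
    Pos-1    : Pos 1#
    Pos-+    : ∀ {a b} → Pos a → Pos b → Pos (a +ᴰ b)
    Pos-*    : ∀ {a b} → Pos a → Pos b → Pos (a * b)
    ¬Pos-0   : ¬ Pos 0#

  Pos⇒≉0 : ∀ {a} → Pos a → ¬ (a ≈ 0#)
  Pos⇒≉0 pos a≈0 = ¬Pos-0 (Pos-resp a≈0 pos)

open PositiveCone using (Pos)

ℚ-cone : PositiveCone ℚ-domain
ℚ-cone = record
  { Pos      = ℚ.Positive
  ; Pos-resp = λ { ≡.refl pos → pos }
  ; Pos-1    = _
  ; Pos-+    = λ {a} {b} p q → ℚₚ.pos+pos⇒pos a {{p}} b {{q}}
  ; Pos-*    = λ {a} {b} p q → ℚₚ.pos*pos⇒pos a {{p}} b {{q}}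
  ; ¬Pos-0   = λ ()
  }

module _ {D : IntegralDomain} (C : PositiveCone D) where
  open IntegralDomain D renaming (_+_ to _+ᴰ_)
  open PositiveCone C hiding (Pos)

  private
    module D[X] = Polynomial D
    module Frac = FractionField D
    open Frac using (_/_[_]; mk; num; den)
    open SemiringSolver commutativeSemiring using (solve; _:+_; _:*_; _:=_)
    open SetoidReasoning setoid

  polyCone : PositiveCone D[X].polyDomain
  polyCone = record
    { Pos      = λ p → Pos C (D[X].at1 p)
    ; Pos-resp = λ {p} {q} e → Pos-resp (at1-cong p q e)
    ; Pos-1    = Pos-resp (sym (+-identityʳ 1#)) Pos-1
    ; Pos-+    = λ {p} {q} s t → Pos-resp (sym (at1-⊕ p q)) (Pos-+ s t)
    ; Pos-*    = λ {p} {q} s t → Pos-resp (sym (at1-⊗ p q)) (Pos-* s t)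
    ; ¬Pos-0   = ¬Pos-0
    }
    where
    at1-cong = proj₁ D[X].at1-properties
    at1-⊕ = proj₁ (proj₂ D[X].at1-properties)
    at1-⊗ = proj₂ (proj₂ D[X].at1-properties)

  PosFraction : Frac.Fraction → Set
  PosFraction f = ∃[ n ] ∃[ d ] (Pos C n × Pos C d × n * den f ≈ num f * d)

  fractionCone : PositiveCone Frac.fractionDomain
  fractionCone = record
    { Pos      = PosFraction
    ; Pos-resp = λ {f} {g} → resp {f} {g}
    ; Pos-1    = 1# , 1# , Pos-1 , Pos-1 , refl
    ; Pos-+    = λ {f} {g} → plus {f} {g}
    ; Pos-*    = λ {f} {g} → times {f} {g}
    ; ¬Pos-0   = λ { (n , d , pn , _ , e) →
        Pos⇒≉0 pn (trans (sym (*-identityʳ n)) (trans e (zeroˡ d))) }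
    }
    where
    resp : ∀ {f g} → f Frac.≃ g → PosFraction f → PosFraction g
    resp {a / b [ b≉0 ]} {a′ / b′ [ _ ]} (mk h) (n , d , pn , pd , e) =
      n , d , pn , pd , *-cancelˡ-nonzero b≉0 (begin
        b * (n * b′) ≈⟨ solve 3 (λ b n b′ → b :* (n :* b′) := (n :* b) :* b′) refl b n b′ ⟩
        (n * b) * b′ ≈⟨ *-congʳ e ⟩
        (a * d) * b′ ≈⟨ solve 3 (λ a d b′ → (a :* d) :* b′ := (a :* b′) :* d) refl a d b′ ⟩
        (a * b′) * d ≈⟨ *-congʳ h ⟩
        (a′ * b) * d ≈⟨ solve 3 (λ a′ b d → (a′ :* b) :* d := b :* (a′ :* d)) refl a′ b d ⟩
        b * (a′ * d) ∎)

    plus : ∀ {f g} → PosFraction f → PosFraction g → PosFraction (f Frac.⊞ g)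
    plus {a / b [ _ ]} {a′ / b′ [ _ ]} (n , d , pn , pd , e) (n′ , d′ , pn′ , pd′ , e′) =
      n * d′ +ᴰ n′ * d , d * d′ , Pos-+ (Pos-* pn pd′) (Pos-* pn′ pd) , Pos-* pd pd′ , (begin
        (n * d′ +ᴰ n′ * d) * (b * b′)
          ≈⟨ solve 6 (λ n d n′ d′ b b′ → (n :* d′ :+ n′ :* d) :* (b :* b′)
               := (n :* b) :* (d′ :* b′) :+ (n′ :* b′) :* (d :* b)) refl n d n′ d′ b b′ ⟩
        (n * b) * (d′ * b′) +ᴰ (n′ * b′) * (d * b)
          ≈⟨ +-cong (*-congʳ e) (*-congʳ e′) ⟩
        (a * d) * (d′ * b′) +ᴰ (a′ * d′) * (d * b)
          ≈⟨ solve 6 (λ a d a′ d′ b b′ → (a :* d) :* (d′ :* b′) :+ (a′ :* d′) :* (d :* b)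
               := (a :* b′ :+ a′ :* b) :* (d :* d′)) refl a d a′ d′ b b′ ⟩
        (a * b′ +ᴰ a′ * b) * (d * d′) ∎)

    times : ∀ {f g} → PosFraction f → PosFraction g → PosFraction (f Frac.⊠ g)
    times {a / b [ _ ]} {a′ / b′ [ _ ]} (n , d , pn , pd , e) (n′ , d′ , pn′ , pd′ , e′) =
      n * n′ , d * d′ , Pos-* pn pn′ , Pos-* pd pd′ , (begin
        (n * n′) * (b * b′)
          ≈⟨ solve 4 (λ n n′ b b′ → (n :* n′) :* (b :* b′) := (n :* b) :* (n′ :* b′)) refl n n′ b b′ ⟩
        (n * b) * (n′ * b′)
          ≈⟨ *-cong e e′ ⟩
        (a * d) * (a′ * d′)
          ≈⟨ solve 4 (λ a d a′ d′ → (a :* d) :* (a′ :* d′) := (a :* a′) :* (d :* d′)) refl a d a′ d′ ⟩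
        (a * a′) * (d * d′) ∎)

  PosFraction-recip : ∀ f → PosFraction f → PosFraction (Frac.recip f)
  PosFraction-recip (a / b [ b≉0 ]) (n , d , pn , pd , e) with a ≟ 0#
  ... | no  _   = d , n , pd , pn , trans (*-comm d a) (trans (sym e) (*-comm n b))
  ... | yes a≈0 = ⊥-elim (*-nonzero (Pos⇒≉0 pn) b≉0
                    (trans e (trans (*-congʳ a≈0) (zeroˡ d))))

  PosFraction-embed : ∀ {a} → Pos C a → PosFraction (Frac.embed a)
  PosFraction-embed {a} pos = a , 1# , pos , Pos-1 , refl

MPoly-cone : ∀ {D} → PositiveCone D → ∀ n → PositiveCone (MPoly D n)
MPoly-cone C zero    = C
MPoly-cone C (suc n) = polyCone (MPoly-cone C n)

Pos-constant : ∀ {D} (C : PositiveCone D) {a} → Pos C a → Pos (polyCone C) (Polynomial.constant D a)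
Pos-constant {D} C pos = PositiveCone.Pos-resp C (sym (+-identityʳ _)) pos
  where open IntegralDomain D

Pos-scalar : ∀ {D} (C : PositiveCone D) n {a} → Pos C a → Pos (MPoly-cone C n) (scalar D n a)
Pos-scalar C zero    pos = pos
Pos-scalar C (suc n) pos = Pos-constant (MPoly-cone C n) (Pos-scalar C n pos)

Pos-variable# : ∀ {D} (C : PositiveCone D) n i → Pos (MPoly-cone C n) (variable# D n i)
Pos-variable# {D} C (suc n) zero =
  PositiveCone.Pos-resp C′ (sym (trans (+-identityˡ _) (+-identityʳ 1#))) (PositiveCone.Pos-1 C′)
  where
  C′ = MPoly-cone C n
  open IntegralDomain (MPoly D n)
Pos-variable# C (suc n) (suc i) = Pos-constant (MPoly-cone C n) (Pos-variable# C n i)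

module PositiveRationalFunctions {D : IntegralDomain} (C : PositiveCone D) (n : ℕ) where
  open RationalFunctions D n

  opaque
    unfolding rationalFunctions constantFunction indeterminate

    cone : PositiveCone integralDomain
    cone = fractionCone (MPoly-cone C n)

    Pos-recip : ∀ a → Pos cone a → Pos cone (DiscreteField._⁻¹ rationalFunctions a)
    Pos-recip = PosFraction-recip (MPoly-cone C n)

    Pos-constantFunction : ∀ {a} → Pos C a → Pos cone (constantFunction a)
    Pos-constantFunction pos = PosFraction-embed (MPoly-cone C n) (Pos-scalar C n pos)

    Pos-indeterminate : ∀ i → Pos cone (indeterminate i)
    Pos-indeterminate i = PosFraction-embed (MPoly-cone C n) (Pos-variable# C n i)

module Exchange (K : DiscreteField) {ℓ₁ ℓ₂ : ℕ}
  (p₁ : Fin (suc ℓ₁) → DiscreteField.Carrier K)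
  (p₂ : Fin (suc ℓ₂) → DiscreteField.Carrier K)
  (X₁ X₂ : DiscreteField.Carrier K) where

  open DiscreteField K hiding (zero) renaming (_+_ to _+ᴷ_)
  open Exponentiation semiring using (_^_)
  open Multiples semiring using () renaming (_×_ to _×ᴷ_)
  open FiniteSum +-commutativeMonoid using (sum)
  open FiniteSum *-commutativeMonoid using () renaming (sum to product)

  P : ∀ {ℓ} → (Fin (suc ℓ) → Carrier) → Carrier → Carrier
  P {ℓ} p z = 1# +ᴷ sum (λ (k : Fin ℓ) → p (suc k) * z ^ toℕ (suc k))

  -- The value at z of the reversed polynomial, for z ≉ 0 only; it is applied
  -- only to the x k, which are nonzero (x≉0 below).
  P̄ : ∀ {ℓ} → (Fin (suc ℓ) → Carrier) → Carrier → Carrier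
  P̄ {ℓ} p z = z ^ ℓ * P p (z ⁻¹) * p (fromℕ ℓ) ⁻¹

  exchangePolynomial : ℤ → Carrier → Carrier
  exchangePolynomial k = byResidue (k %ℕ 4)
    where
    byResidue : ℕ → Carrier → Carrier
    byResidue 1 = P p₁
    byResidue 2 = P p₂
    byResidue 3 = P̄ p₁
    byResidue _ = P̄ p₂

  -- upward n is x (1 + n) and downward n is x (2 - n).
  upward : ℕ → Carrier
  upward 0             = X₁
  upward 1             = X₂
  upward (suc (suc n)) =
    exchangePolynomial (+ (2 + n)) (upward (suc n)) * upward n ⁻¹

  downward : ℕ → Carrier
  downward 0             = X₂
  downward 1             = X₁
  downward (suc (suc n)) =
    exchangePolynomial (1ℤ ℤ.- + n) (downward (suc n)) * downward n ⁻¹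

  x : ℤ → Carrier
  x +[1+ n ] = upward n
  x (+ 0)    = downward 2
  x -[1+ n ] = downward (3 + n)

  infixr 8 _^ℤ_
  _^ℤ_ : Carrier → ℤ → Carrier
  a ^ℤ (+ n)    = a ^ n
  a ^ℤ -[1+ n ] = (a ⁻¹) ^ suc n

  infixr 8 _·ℤ_
  _·ℤ_ : ℤ → Carrier → Carrier
  (+ n)    ·ℤ a = n ×ᴷ a
  -[1+ n ] ·ℤ a = - (suc n ×ᴷ a)

  -- Exponent vectors of Laurent monomials in p₁,₁ … p₁,ℓ₁ and p₂,₁ … p₂,ℓ₂.
  ℙ : Set
  ℙ = Vector ℤ ℓ₁ × Vector ℤ ℓ₂

  monomial : ℙ → Carrier
  monomial (a , b) =
    product (λ k → p₁ (suc k) ^ℤ a k) * product (λ k → p₂ (suc k) ^ℤ b k)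

  combination : List (ℤ × ℙ) → Carrier
  combination = foldr (λ { (c , m) s → c ·ℤ monomial m +ᴷ s }) 0#

  -- ℤ[ℙ] as a subring of K: the finite ℤ-linear combinations of monomials.
  ℤ[ℙ] : Pred Carrier 0ℓ
  ℤ[ℙ] f = ∃[ c ] f ≈ combination c

  -- The ℤ[ℙ]-subalgebra of K generated by S.
  data ℤ[ℙ][_] (S : Pred Carrier 0ℓ) : Pred Carrier 0ℓ where
    scalars   : ∀ {f}   → ℤ[ℙ] f → ℤ[ℙ][ S ] f
    generator : ∀ {f}   → S f → ℤ[ℙ][ S ] f
    plus      : ∀ {f g} → ℤ[ℙ][ S ] f → ℤ[ℙ][ S ] g → ℤ[ℙ][ S ] (f +ᴷ g)
    times     : ∀ {f g} → ℤ[ℙ][ S ] f → ℤ[ℙ][ S ] g → ℤ[ℙ][ S ] (f * g)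
    respects  : ∀ {f g} → f ≈ g → ℤ[ℙ][ S ] f → ℤ[ℙ][ S ] g

  𝓐 : Pred Carrier 0ℓ
  𝓐 = ℤ[ℙ][ (λ f → ∃[ k ] f ≡ x k) ]

  module NonVanishing
    (C : PositiveCone integralDomain)
    (Pos-⁻¹ : ∀ a → Pos C a → Pos C (a ⁻¹))
    (Pos-p₁ : ∀ k → Pos C (p₁ k)) (Pos-p₂ : ∀ k → Pos C (p₂ k))
    (Pos-X₁ : Pos C X₁) (Pos-X₂ : Pos C X₂) where

    open PositiveCone C hiding (Pos)

    private
      Pos-^ : ∀ {a} n → Pos C a → Pos C (a ^ n)
      Pos-^ zero    pos = Pos-1
      Pos-^ (suc n) pos = Pos-* pos (Pos-^ n pos)

      Pos-1+sum : ∀ {n a} (t : Fin n → Carrier) →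
                  Pos C a → (∀ k → Pos C (t k)) → Pos C (a +ᴷ sum t)
      Pos-1+sum {zero}  t pos-a pos-t = Pos-resp (sym (+-identityʳ _)) pos-a
      Pos-1+sum {suc n} t pos-a pos-t = Pos-resp (+-assoc _ _ _)
        (Pos-1+sum (λ k → t (suc k)) (Pos-+ pos-a (pos-t zero)) (λ k → pos-t (suc k)))

      Pos-P : ∀ {ℓ} (p : Fin (suc ℓ) → Carrier) → (∀ k → Pos C (p k)) →
              ∀ {z} → Pos C z → Pos C (P p z)
      Pos-P p pos-p pos-z =
        Pos-1+sum _ Pos-1 (λ k → Pos-* (pos-p (suc k)) (Pos-^ (toℕ (suc k)) pos-z))

      Pos-P̄ : ∀ {ℓ} (p : Fin (suc ℓ) → Carrier) → (∀ k → Pos C (p k)) →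
              ∀ {z} → Pos C z → Pos C (P̄ p z)
      Pos-P̄ {ℓ} p pos-p pos-z =
        Pos-* (Pos-* (Pos-^ ℓ pos-z) (Pos-P p pos-p (Pos-⁻¹ _ pos-z))) (Pos-⁻¹ _ (pos-p (fromℕ ℓ)))

      Pos-exchange : ∀ k {z} → Pos C z → Pos C (exchangePolynomial k z)
      Pos-exchange k pos with k %ℕ 4
      ... | 0 = Pos-P̄ p₂ Pos-p₂ pos
      ... | 1 = Pos-P p₁ Pos-p₁ pos
      ... | 2 = Pos-P p₂ Pos-p₂ pos
      ... | 3 = Pos-P̄ p₁ Pos-p₁ pos
      ... | suc (suc (suc (suc _))) = Pos-P̄ p₂ Pos-p₂ pos

      Pos-upward : ∀ n → Pos C (upward n)
      Pos-upward 0             = Pos-X₁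
      Pos-upward 1             = Pos-X₂
      Pos-upward (suc (suc n)) =
        Pos-* (Pos-exchange (+ (2 + n)) (Pos-upward (suc n))) (Pos-⁻¹ _ (Pos-upward n))

      Pos-downward : ∀ n → Pos C (downward n)
      Pos-downward 0             = Pos-X₂
      Pos-downward 1             = Pos-X₁
      Pos-downward (suc (suc n)) =
        Pos-* (Pos-exchange (1ℤ ℤ.- + n) (Pos-downward (suc n))) (Pos-⁻¹ _ (Pos-downward n))

      Pos-x : ∀ k → Pos C (x k)
      Pos-x +[1+ n ] = Pos-upward n
      Pos-x (+ 0)    = Pos-downward 2
      Pos-x -[1+ n ] = Pos-downward (3 + n)

      [b/a]*a : ∀ {a b} → Pos C a → b * a ⁻¹ * a ≈ b
      [b/a]*a {a} {b} pos =
        trans (*-assoc b (a ⁻¹) a)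
          (trans (*-congˡ (trans (*-comm (a ⁻¹) a) (⁻¹-inverseʳ (Pos⇒≉0 pos)))) (*-identityʳ b))

      a*[b/a] : ∀ {a b} → Pos C a → a * (b * a ⁻¹) ≈ b
      a*[b/a] pos = trans (*-comm _ _) ([b/a]*a pos)

      relation : ∀ k → x (ℤ.suc k) * x (ℤ.pred k) ≈ exchangePolynomial k (x k)
      relation +[1+ suc n ] = [b/a]*a (Pos-upward n)
      relation +[1+ 0 ]     = a*[b/a] Pos-X₂
      relation (+ 0)        = a*[b/a] Pos-X₁
      relation -[1+ 0 ]     = a*[b/a] (Pos-downward 2)
      relation -[1+ suc n ] = a*[b/a] (Pos-downward (3 + n))

    x≉0 : ∀ k → ¬ (x k ≈ 0#)
    x≉0 k = Pos⇒≉0 (Pos-x k)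

    exchange-relation : ∀ k → x (k ℤ.+ 1ℤ) * x (k ℤ.- 1ℤ) ≈ exchangePolynomial k (x k)
    exchange-relation k
      rewrite ℤₚ.+-comm k 1ℤ | ℤₚ.+-comm k (ℤ.- 1ℤ) = relation k

-- The first ℓ₁ indeterminates of ℚ⟨p⟩ are p₁,₁ … p₁,ℓ₁, the other ℓ₂ are
-- p₂,₁ … p₂,ℓ₂.
module ClusterAlgebra (ℓ₁ ℓ₂ : ℕ) where
  private
    module ℚ⟨p⟩ = RationalFunctions ℚ-domain (ℓ₁ + ℓ₂)
    module ℚ⟨p⟩⟨x⟩ = RationalFunctions ℚ⟨p⟩.integralDomain 2

  𝓕 : DiscreteField
  𝓕 = ℚ⟨p⟩⟨x⟩.rationalFunctions

  open DiscreteField 𝓕 using (Carrier; _≈_; 0#; 1#; _*_)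

  p₁ : Fin (suc ℓ₁) → Carrier
  p₁ zero    = 1#
  p₁ (suc k) = ℚ⟨p⟩⟨x⟩.constantFunction (ℚ⟨p⟩.indeterminate (k ↑ˡ ℓ₂))

  p₂ : Fin (suc ℓ₂) → Carrier
  p₂ zero    = 1#
  p₂ (suc k) = ℚ⟨p⟩⟨x⟩.constantFunction (ℚ⟨p⟩.indeterminate (ℓ₁ ↑ʳ k))

  x₁ x₂ : Carrier
  x₁ = ℚ⟨p⟩⟨x⟩.indeterminate zero
  x₂ = ℚ⟨p⟩⟨x⟩.indeterminate (suc zero)

  open Exchange 𝓕 p₁ p₂ x₁ x₂ public hiding (module NonVanishing)

  private
    module ℚ⟨p⟩⁺ = PositiveRationalFunctions ℚ-cone (ℓ₁ + ℓ₂)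
    module ℚ⟨p⟩⟨x⟩⁺ = PositiveRationalFunctions ℚ⟨p⟩⁺.cone 2
    open PositiveCone ℚ⟨p⟩⟨x⟩⁺.cone using (Pos-1; Pos⇒≉0)

    Pos-p₁ : ∀ k → Pos ℚ⟨p⟩⟨x⟩⁺.cone (p₁ k)
    Pos-p₁ zero    = Pos-1
    Pos-p₁ (suc k) = ℚ⟨p⟩⟨x⟩⁺.Pos-constantFunction (ℚ⟨p⟩⁺.Pos-indeterminate (k ↑ˡ ℓ₂))

    Pos-p₂ : ∀ k → Pos ℚ⟨p⟩⟨x⟩⁺.cone (p₂ k)
    Pos-p₂ zero    = Pos-1
    Pos-p₂ (suc k) = ℚ⟨p⟩⟨x⟩⁺.Pos-constantFunction (ℚ⟨p⟩⁺.Pos-indeterminate (ℓ₁ ↑ʳ k))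

    module NonVanishing = Exchange.NonVanishing 𝓕 p₁ p₂ x₁ x₂
      ℚ⟨p⟩⟨x⟩⁺.cone ℚ⟨p⟩⟨x⟩⁺.Pos-recip Pos-p₁ Pos-p₂
      (ℚ⟨p⟩⟨x⟩⁺.Pos-indeterminate zero) (ℚ⟨p⟩⟨x⟩⁺.Pos-indeterminate (suc zero))

  p₁≉0 : ∀ k → ¬ (p₁ k ≈ 0#)
  p₁≉0 k = Pos⇒≉0 (Pos-p₁ k)

  p₂≉0 : ∀ k → ¬ (p₂ k ≈ 0#)
  p₂≉0 k = Pos⇒≉0 (Pos-p₂ k)

  x≉0 : ∀ k → ¬ (x k ≈ 0#)
  x≉0 = NonVanishing.x≉0

  exchange-relation : ∀ k → x (k ℤ.+ 1ℤ) * x (k ℤ.- 1ℤ) ≈ exchangePolynomial k (x k)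
  exchange-relation = NonVanishing.exchange-relation

{-# OPTIONS --safe #-}
-- Put w = x_{k+1}. Modulo w the element x_k x_{k+2} is the value at w of a
-- polynomial with constant term 1, so x_k and x_{k+2} are inverse to each
-- other. Hence x_{k+2}^ℓ P(x_k) is congruent to x_{k+2}^ℓ P(1/x_{k+2}), which up
-- to a unit of ℤ[ℙ] is x_{k+1} x_{k+3}; as P(x_k) = x_{k-1} x_{k+1} ≡ 0, also
-- x_{k+1} x_{k+3} ≡ 0, and cancelling w puts x_{k+3} in the subalgebra generated
-- by x_{k-1}, …, x_{k+2}. The argument is symmetric under reversal of the
-- sequence, so windows of four consecutive x_j propagate in both directions.
module Submission where

open import Defs
open import Data.Nat.Base using (ℕ; NonZero)
open import Data.Integer.Base using (ℤ; +_; 1ℤ; _+_; _-_)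
open import Relation.Unary using (_≐_; _∪_; ｛_｝)

open import Algebra.Bundles using (CommutativeRing)
import Algebra.Properties.CommutativeMonoid.Sum as FiniteSum
import Algebra.Properties.CommutativeSemiring.Exp as CommutativeExponentiation
import Algebra.Properties.Ring as RingProperties
import Algebra.Properties.Semiring.Exp as Exponentiation
import Algebra.Properties.Semiring.Sum as SemiringSum
import Algebra.Solver.Ring.NaturalCoefficients.Default as SemiringSolver
open import Data.Fin.Base using (Fin; zero; suc; toℕ; fromℕ)
open import Data.Fin.Properties using (toℕ<n)
open import Data.Integer.Base as ℤ using (+[1+_]; -[1+_]; 0ℤ; -1ℤ; _%ℕ_)
import Data.Integer.Properties as ℤₚ
open import Data.List.Base using ([]; _∷_)
open import Data.Nat.Base as ℕ using (zero; suc; z≤n; s≤s; _∸_)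
open import Data.Product.Base using (_×_; _,_; ∃-syntax)
open import Data.Sum.Base using (inj₁; inj₂)
open import Data.Vec.Functional using (Vector; replicate; updateAt)
open import Function.Base using (const)
open import Level using (0ℓ)
open import Relation.Binary.Bundles using (Setoid)
open import Relation.Binary.PropositionalEquality as ≡ using (_≡_)
import Relation.Binary.Reasoning.Setoid as SetoidReasoning
open import Relation.Nullary.Negation using (¬_)
open import Relation.Unary using (Pred)

-- Every path is routed through 0, so that both legs recurse structurally on the constructors of
-- `ℤ`.
ℤ-induction : (Q : Pred ℤ 0ℓ) →
  (∀ j → Q j → Q (ℤ.suc j)) → (∀ j → Q (ℤ.suc j) → Q j) →
  ∀ i → Q i → ∀ j → Q j
ℤ-induction Q up down i q = fromZero (toZero i q)
  where
  toZero : ∀ i → Q i → Q 0ℤ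
  toZero (+ zero)     q = q
  toZero +[1+ n ]     q = toZero (+ n) (down _ q)
  toZero -[1+ zero ]  q = up _ q
  toZero -[1+ suc n ] q = toZero -[1+ n ] (up _ q)

  fromZero : Q 0ℤ → ∀ j → Q j
  fromZero q (+ zero)     = q
  fromZero q +[1+ n ]     = up _ (fromZero q (+ n))
  fromZero q -[1+ zero ]  = down _ q
  fromZero q -[1+ suc n ] = down _ (fromZero q -[1+ n ])

-- Subrings of a commutative ring

module _ (R : CommutativeRing 0ℓ 0ℓ) where
  open CommutativeRing R hiding (zero) renaming (_+_ to _+ᴿ_; _-_ to _-ᴿ_)

  record IsSubring (A : Pred Carrier 0ℓ) : Set where
    field
      resp : ∀ {a b} → a ≈ b → A a → A b
      1∈   : A 1#
      +∈   : ∀ {a b} → A a → A b → A (a +ᴿ b)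
      *∈   : ∀ {a b} → A a → A b → A (a * b)
      -∈   : ∀ {a} → A a → A (- a)

    0∈ : A 0#
    0∈ = resp (-‿inverseʳ 1#) (+∈ 1∈ (-∈ 1∈))

    open Exponentiation semiring using (_^_)

    ^∈ : ∀ {a} → A a → ∀ n → A (a ^ n)
    ^∈ a∈ zero    = 1∈
    ^∈ a∈ (suc n) = *∈ a∈ (^∈ a∈ n)

    open FiniteSum +-commutativeMonoid using (sum)

    sum∈ : ∀ {n} (t : Vector Carrier n) → (∀ k → A (t k)) → A (sum t)
    sum∈ {zero}  t t∈ = 0∈
    sum∈ {suc n} t t∈ = +∈ (t∈ zero) (sum∈ (λ k → t (suc k)) (λ k → t∈ (suc k)))

-- Congruence modulo `w`

-- a ∼ b says that a and b are congruent modulo wA; they need not lie in A.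
module Congruence (R : CommutativeRing 0ℓ 0ℓ) {A : Pred (CommutativeRing.Carrier R) 0ℓ}
  (isSubring : IsSubring R A) (w : CommutativeRing.Carrier R) where

  open CommutativeRing R hiding (zero) renaming (_+_ to _+ᴿ_; _-_ to _-ᴿ_)
  open IsSubring isSubring
  open Exponentiation semiring using (_^_)
  open FiniteSum +-commutativeMonoid using (sum)
  open SemiringSolver commutativeSemiring using (solve; _:+_; _:*_; _:=_)

  infix 4 _∼_
  _∼_ : Carrier → Carrier → Set
  a ∼ b = ∃[ s ] (A s × a ≈ b +ᴿ w * s)

  ∼-reflexive : ∀ {a b} → a ≈ b → a ∼ b
  ∼-reflexive a≈b = 0# , 0∈ ,
    trans a≈b (sym (trans (+-congˡ (zeroʳ w)) (+-identityʳ _)))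

  ∼-refl : ∀ {a} → a ∼ a
  ∼-refl = ∼-reflexive refl

  ∼-sym : ∀ {a b} → a ∼ b → b ∼ a
  ∼-sym {a} {b} (s , s∈ , e) = - s , -∈ s∈ , sym (begin
    a +ᴿ w * - s            ≈⟨ +-congʳ e ⟩
    b +ᴿ w * s +ᴿ w * - s   ≈⟨ solve 4 (λ b w s s′ → b :+ w :* s :+ w :* s′ := b :+ w :* (s :+ s′))
                                 refl b w s (- s) ⟩
    b +ᴿ w * (s +ᴿ - s)     ≈⟨ +-congˡ (trans (*-congˡ (-‿inverseʳ s)) (zeroʳ w)) ⟩
    b +ᴿ 0#                 ≈⟨ +-identityʳ b ⟩
    b                       ∎)
    where open SetoidReasoning setoid

  ∼-trans : ∀ {a b c} → a ∼ b → b ∼ c → a ∼ c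
  ∼-trans {a} {b} {c} (s , s∈ , e) (t , t∈ , f) = t +ᴿ s , +∈ t∈ s∈ ,
    trans e (trans (+-congʳ f)
      (solve 4 (λ c w t s → c :+ w :* t :+ w :* s := c :+ w :* (t :+ s)) refl c w t s))

  ∼-setoid : Setoid 0ℓ 0ℓ
  ∼-setoid = record
    { Carrier       = Carrier
    ; _≈_           = _∼_
    ; isEquivalence = record { refl = ∼-refl ; sym = ∼-sym ; trans = ∼-trans }
    }

  +-cong-∼ : ∀ {a b c d} → a ∼ b → c ∼ d → a +ᴿ c ∼ b +ᴿ d
  +-cong-∼ {a} {b} {c} {d} (s , s∈ , e) (t , t∈ , f) = s +ᴿ t , +∈ s∈ t∈ ,
    trans (+-cong e f)
      (solve 5 (λ b d w s t → (b :+ w :* s) :+ (d :+ w :* t) := (b :+ d) :+ w :* (s :+ t))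
        refl b d w s t)

  -- The factor `c` has to lie in `A`, because it multiplies the witness `s`; the congruent elements
  -- stay arbitrary.
  *-congˡ-∼ : ∀ {c a b} → A c → a ∼ b → c * a ∼ c * b
  *-congˡ-∼ {c} {a} {b} c∈ (s , s∈ , e) = c * s , *∈ c∈ s∈ ,
    trans (*-congˡ e)
      (solve 4 (λ c b w s → c :* (b :+ w :* s) := c :* b :+ w :* (c :* s)) refl c b w s)

  *-congʳ-∼ : ∀ {c a b} → A c → a ∼ b → a * c ∼ b * c
  *-congʳ-∼ {c} {a} {b} c∈ a∼b = begin
    a * c ≈⟨ ∼-reflexive (*-comm a c) ⟩
    c * a ≈⟨ *-congˡ-∼ c∈ a∼b ⟩
    c * b ≈⟨ ∼-reflexive (*-comm c b) ⟩
    b * c ∎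
    where open SetoidReasoning ∼-setoid

  sum-cong-∼ : ∀ {n} {t u : Vector Carrier n} → (∀ k → t k ∼ u k) → sum t ∼ sum u
  sum-cong-∼ {zero}  t∼u = ∼-refl
  sum-cong-∼ {suc n} t∼u = +-cong-∼ (t∼u zero) (sum-cong-∼ (λ k → t∼u (suc k)))

  multiple∼0 : ∀ {a s} → A s → a ≈ w * s → a ∼ 0#
  multiple∼0 s∈ a≈ws = _ , s∈ , trans a≈ws (sym (+-identityˡ _))

  ^∼1 : ∀ {a} → A a → a ∼ 1# → ∀ n → a ^ n ∼ 1#
  ^∼1 a∈ a∼1 zero    = ∼-refl
  ^∼1 {a} a∈ a∼1 (suc n) = begin
    a * a ^ n ≈⟨ *-congˡ-∼ a∈ (^∼1 a∈ a∼1 n) ⟩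
    a * 1#    ≈⟨ ∼-reflexive (*-identityʳ a) ⟩
    a         ≈⟨ a∼1 ⟩
    1#        ∎
    where open SetoidReasoning ∼-setoid

  -- Each `z` is paired with one `y`. Only the product `z * y` is asked to lie in `A`, so that `z`
  -- may be `y ⁻¹`.
  power-cancel : ∀ {y z} → A y → A (z * y) → z * y ∼ 1# →
                 ∀ {j n} → j ℕ.≤ n → y ^ n * z ^ j ∼ y ^ (n ∸ j)
  power-cancel y∈ zy∈ zy∼1 z≤n = ∼-reflexive (*-identityʳ _)
  power-cancel {y} {z} y∈ zy∈ zy∼1 (s≤s {j} {n} j≤n) = begin
    (y * y ^ n) * (z * z ^ j)
      ≈⟨ ∼-reflexive (solve 4 (λ y yn z zj → (y :* yn) :* (z :* zj) := (z :* y) :* (yn :* zj))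
           refl y (y ^ n) z (z ^ j)) ⟩
    (z * y) * (y ^ n * z ^ j)
      ≈⟨ *-congˡ-∼ zy∈ (power-cancel y∈ zy∈ zy∼1 j≤n) ⟩
    (z * y) * y ^ (n ∸ j)
      ≈⟨ *-congʳ-∼ (^∈ y∈ (n ∸ j)) zy∼1 ⟩
    1# * y ^ (n ∸ j)
      ≈⟨ ∼-reflexive (*-identityˡ _) ⟩
    y ^ (n ∸ j) ∎
    where open SetoidReasoning ∼-setoid

  -- When `p zero ≈ 1#` and `y ≉ 0`, this is `y ^ ℓ * P p (y ⁻¹)` written without an inverse, that
  -- is, `P̄ p y` times the leading coefficient.
  reversal : ∀ {ℓ} → (Fin (suc ℓ) → Carrier) → Carrier → Carrier
  reversal {ℓ} p y = sum (λ (k : Fin (suc ℓ)) → p k * y ^ (ℓ ∸ toℕ k))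

  -- All terms but the last carry a positive power of `w`.
  reversal∼leading : A w → ∀ {ℓ} (p : Fin (suc ℓ) → Carrier) → (∀ k → A (p k)) →
                     reversal p w ∼ p (fromℕ ℓ)
  reversal∼leading w∈ {zero}  p p∈ =
    ∼-reflexive (trans (+-identityʳ _) (*-identityʳ _))
  reversal∼leading w∈ {suc ℓ} p p∈ = begin
    -- `suc ℓ ∸ toℕ (suc k)` reduces to `ℓ ∸ toℕ k`, so the rest of the sum is the reversal of the
    -- shifted coefficients.
    p zero * (w * w ^ ℓ) +ᴿ reversal (λ k → p (suc k)) w
      ≈⟨ +-cong-∼
           (multiple∼0 (*∈ (p∈ zero) (^∈ w∈ ℓ))
             (solve 3 (λ a w v → a :* (w :* v) := w :* (a :* v)) refl (p zero) w (w ^ ℓ)))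
           (reversal∼leading w∈ (λ k → p (suc k)) (λ k → p∈ (suc k))) ⟩
    0# +ᴿ p (fromℕ (suc ℓ))
      ≈⟨ ∼-reflexive (+-identityˡ _) ⟩
    p (fromℕ (suc ℓ)) ∎
    where open SetoidReasoning ∼-setoid

-- Scalars, generated subalgebras and reciprocal polynomials

module GeneratedSubalgebra (K : DiscreteField) {ℓ₁ ℓ₂ : ℕ}
  (p₁ : Fin (suc ℓ₁) → DiscreteField.Carrier K)
  (p₂ : Fin (suc ℓ₂) → DiscreteField.Carrier K)
  (X₁ X₂ : DiscreteField.Carrier K) where

  open DiscreteField K hiding (zero) renaming (_+_ to _+ᴷ_; _-_ to _-ᴷ_)
  open Exchange K p₁ p₂ X₁ X₂
  open Exponentiation semiring using (_^_)
  open FiniteSum +-commutativeMonoid using (sum)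
  open FiniteSum *-commutativeMonoid using ()
    renaming (sum to product; sum-replicate-zero to product-replicate-one)

  product-unitVector : ∀ {n} (a : Fin n → Carrier) i c →
    product (λ k → a k ^ℤ updateAt (replicate n 0ℤ) i (const c) k) ≈ a i ^ℤ c
  product-unitVector {suc n} a zero    c =
    trans (*-congˡ (product-replicate-one n)) (*-identityʳ _)
  product-unitVector {suc n} a (suc i) c =
    trans (*-identityˡ _) (product-unitVector (λ k → a (suc k)) i c)

  ℤ[ℙ]-resp : ∀ {a b} → a ≈ b → ℤ[ℙ] a → ℤ[ℙ] b
  ℤ[ℙ]-resp a≈b (c , a≈c) = c , trans (sym a≈b) a≈c

  monomial∈ : ∀ m → ℤ[ℙ] (monomial m)
  monomial∈ m = (1ℤ , m) ∷ [] , sym (trans (+-identityʳ _) (+-identityʳ _))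

  monomial-1 : monomial (replicate ℓ₁ 0ℤ , replicate ℓ₂ 0ℤ) ≈ 1#
  monomial-1 = trans (*-cong (product-replicate-one ℓ₁) (product-replicate-one ℓ₂)) (*-identityˡ 1#)

  1∈ℤ[ℙ] : ℤ[ℙ] 1#
  1∈ℤ[ℙ] = ℤ[ℙ]-resp monomial-1 (monomial∈ (replicate ℓ₁ 0ℤ , replicate ℓ₂ 0ℤ))

  -- `ℤ[ℙ][_]` has no constructor for negatives; they come from multiplication by this scalar.
  -1∈ℤ[ℙ] : ℤ[ℙ] (- 1#)
  -1∈ℤ[ℙ] = (-1ℤ , (replicate ℓ₁ 0ℤ , replicate ℓ₂ 0ℤ)) ∷ [] ,
    sym (trans (+-identityʳ _) (-‿cong (trans (+-identityʳ _) monomial-1)))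

  p₁^∈ℤ[ℙ] : ∀ k c → ℤ[ℙ] (p₁ (suc k) ^ℤ c)
  p₁^∈ℤ[ℙ] k c = ℤ[ℙ]-resp
    (trans (*-cong (product-unitVector (λ k → p₁ (suc k)) k c) (product-replicate-one ℓ₂))
           (*-identityʳ _))
    (monomial∈ (updateAt (replicate ℓ₁ 0ℤ) k (const c) , replicate ℓ₂ 0ℤ))

  p₂^∈ℤ[ℙ] : ∀ k c → ℤ[ℙ] (p₂ (suc k) ^ℤ c)
  p₂^∈ℤ[ℙ] k c = ℤ[ℙ]-resp
    (trans (*-cong (product-replicate-one ℓ₁) (product-unitVector (λ k → p₂ (suc k)) k c))
           (*-identityˡ _))
    (monomial∈ (replicate ℓ₁ 0ℤ , updateAt (replicate ℓ₂ 0ℤ) k (const c)))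

  record UnitCoefficients {ℓ} (p : Fin (suc ℓ) → Carrier) : Set where
    field
      constant≈1 : p zero ≈ 1#
      p≉0        : ∀ k → ¬ (p k ≈ 0#)
      p∈ℤ[ℙ]     : ∀ k → ℤ[ℙ] (p k)
      p⁻¹∈ℤ[ℙ]   : ∀ k → ℤ[ℙ] (p k ⁻¹)

  unitCoefficients : ∀ {ℓ} {p : Fin (suc ℓ) → Carrier} → p zero ≈ 1# →
    (∀ k → ¬ (p k ≈ 0#)) → (∀ k c → ℤ[ℙ] (p (suc k) ^ℤ c)) → UnitCoefficients p
  unitCoefficients {p = p} p₀≈1 p≉0 p^∈ = record
    { constant≈1 = p₀≈1
    ; p≉0        = p≉0
    ; p∈ℤ[ℙ]     = λ { zero    → ℤ[ℙ]-resp (sym p₀≈1) 1∈ℤ[ℙ]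
                     ; (suc k) → ℤ[ℙ]-resp (*-identityʳ _) (p^∈ k 1ℤ) }
    ; p⁻¹∈ℤ[ℙ]   = λ { zero    → ℤ[ℙ]-resp p₀⁻¹≈1 1∈ℤ[ℙ]
                     ; (suc k) → ℤ[ℙ]-resp (*-identityʳ _) (p^∈ k -1ℤ) }
    }
    where
    p₀⁻¹≈1 : 1# ≈ p zero ⁻¹
    p₀⁻¹≈1 = trans (sym (⁻¹-inverseʳ (p≉0 zero))) (trans (*-congʳ p₀≈1) (*-identityˡ _))

  isSubring : ∀ S → IsSubring commutativeRing ℤ[ℙ][ S ]
  isSubring S = record
    { resp = respects
    ; 1∈   = scalars 1∈ℤ[ℙ]
    ; +∈   = plus
    ; *∈   = times
    ; -∈   = λ a∈ → respects (RingProperties.-1*x≈-x ring _) (times (scalars -1∈ℤ[ℙ]) a∈)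
    }

  generated-⊆ : ∀ {S T : Pred Carrier 0ℓ} → (∀ {f} → S f → ℤ[ℙ][ T ] f) →
                ∀ {f} → ℤ[ℙ][ S ] f → ℤ[ℙ][ T ] f
  generated-⊆ S⊆ (scalars c)       = scalars c
  generated-⊆ S⊆ (generator s)     = S⊆ s
  generated-⊆ S⊆ (plus f∈ g∈)      = plus (generated-⊆ S⊆ f∈) (generated-⊆ S⊆ g∈)
  generated-⊆ S⊆ (times f∈ g∈)     = times (generated-⊆ S⊆ f∈) (generated-⊆ S⊆ g∈)
  generated-⊆ S⊆ (respects f≈g f∈) = respects f≈g (generated-⊆ S⊆ f∈)

  -- A function on `Carrier` does not remember its coefficients, so the relation stores them. Its
  -- symmetry lets one argument serve both directions of the sequence.
  data Reciprocal : (Carrier → Carrier) → (Carrier → Carrier) → Set where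
    P-P̄ : ∀ {ℓ} (p : Fin (suc ℓ) → Carrier) → UnitCoefficients p → Reciprocal (P p) (P̄ p)
    P̄-P : ∀ {ℓ} (p : Fin (suc ℓ) → Carrier) → UnitCoefficients p → Reciprocal (P̄ p) (P p)

  Reciprocal-sym : ∀ {Q Q′} → Reciprocal Q Q′ → Reciprocal Q′ Q
  Reciprocal-sym (P-P̄ p c) = P̄-P p c
  Reciprocal-sym (P̄-P p c) = P-P̄ p c

  -- Polynomial values modulo a nonzero element of the subalgebra

  module ModuloGenerator (S : Pred Carrier 0ℓ) {w : Carrier}
    (w≉0 : ¬ (w ≈ 0#)) (w∈ : ℤ[ℙ][ S ] w) where

    open IsSubring (isSubring S)
    open Congruence commutativeRing (isSubring S) w
    open SetoidReasoning ∼-setoid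
    open SemiringSolver commutativeSemiring using (solve; _:*_; _:=_)

    private
      A : Pred Carrier 0ℓ
      A = ℤ[ℙ][ S ]

    ⁻¹-inverseˡ : ∀ {a} → ¬ (a ≈ 0#) → a ⁻¹ * a ≈ 1#
    ⁻¹-inverseˡ a≉0 = trans (*-comm _ _) (⁻¹-inverseʳ a≉0)

    -- Cancelling `w` in the domain identifies `b` with the witness of the congruence. This is how
    -- new elements enter the subalgebra.
    multiple∼0⇒∈ : ∀ {b} → w * b ∼ 0# → A b
    multiple∼0⇒∈ (s , s∈ , wb≈0+ws) =
      resp (sym (*-cancelˡ-nonzero w≉0 (trans wb≈0+ws (+-identityˡ _)))) s∈

    module _ {ℓ} {p : Fin (suc ℓ) → Carrier} (coefficients : UnitCoefficients p) where
      open UnitCoefficients coefficients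

      p∈ : ∀ k → A (p k)
      p∈ k = scalars (p∈ℤ[ℙ] k)

      p⁻¹∈ : ∀ k → A (p k ⁻¹)
      p⁻¹∈ k = scalars (p⁻¹∈ℤ[ℙ] k)

      P∈ : ∀ {z} → A z → A (P p z)
      P∈ z∈ = +∈ 1∈ (sum∈ _ (λ k → *∈ (p∈ (suc k)) (^∈ z∈ (toℕ (suc k)))))

      -- Here `z` is an inverse of `y` modulo `w`: either the true inverse, possibly outside `A`, or
      -- a term of the sequence.
      y^ℓP∼reversal : ∀ {y z} → A y → A (z * y) → z * y ∼ 1# →
                      y ^ ℓ * P p z ∼ reversal p y
      y^ℓP∼reversal {y} {z} y∈ zy∈ zy∼1 = begin
        y ^ ℓ * P p z
          -- The constant term 1 is rewritten as `p zero`, which makes `y ^ ℓ` the zeroth term of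
          -- the reversal.
          ≈⟨ ∼-reflexive (trans (distribˡ _ _ _)
               (+-cong (trans (*-comm _ _) (*-congʳ (sym constant≈1)))
                 (SemiringSum.*-distribˡ-sum semiring (y ^ ℓ) (λ k → p (suc k) * z ^ toℕ (suc k))))) ⟩
        p zero * y ^ ℓ +ᴷ sum (λ k → y ^ ℓ * (p (suc k) * z ^ toℕ (suc k)))
          ≈⟨ +-cong-∼ ∼-refl (sum-cong-∼ term) ⟩
        reversal p y ∎
        where
        term : ∀ k → y ^ ℓ * (p (suc k) * z ^ toℕ (suc k)) ∼ p (suc k) * y ^ (ℓ ∸ toℕ (suc k))
        term k = begin
          y ^ ℓ * (p (suc k) * z ^ toℕ (suc k))
            ≈⟨ ∼-reflexive (solve 3 (λ a b c → a :* (b :* c) := b :* (a :* c))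
                 refl (y ^ ℓ) (p (suc k)) (z ^ toℕ (suc k))) ⟩
          p (suc k) * (y ^ ℓ * z ^ toℕ (suc k))
            -- `toℕ k < ℓ` is exactly the bound `toℕ (suc k) ≤ ℓ` on the exponent.
            ≈⟨ *-congˡ-∼ (p∈ (suc k)) (power-cancel y∈ zy∈ zy∼1 (toℕ<n k)) ⟩
          p (suc k) * y ^ (ℓ ∸ toℕ (suc k)) ∎

      y^ℓP⁻¹∼reversal : ∀ {y} → ¬ (y ≈ 0#) → A y → y ^ ℓ * P p (y ⁻¹) ∼ reversal p y
      y^ℓP⁻¹∼reversal y≉0 y∈ =
        y^ℓP∼reversal y∈ (resp (sym (⁻¹-inverseˡ y≉0)) 1∈) (∼-reflexive (⁻¹-inverseˡ y≉0))

      P∼1 : P p w ∼ 1#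
      P∼1 = begin
        1# +ᴷ sum (λ k → p (suc k) * w ^ toℕ (suc k))
          ≈⟨ +-cong-∼ ∼-refl (multiple∼0
               (sum∈ _ (λ k → *∈ (p∈ (suc k)) (^∈ w∈ (toℕ k))))
               (trans (sum-cong-≋ (λ k →
                   solve 3 (λ a w v → a :* (w :* v) := w :* (a :* v)) refl (p (suc k)) w (w ^ toℕ k)))
                 (sym (*-distribˡ-sum w (λ k → p (suc k) * w ^ toℕ k))))) ⟩
        1# +ᴷ 0#
          ≈⟨ ∼-reflexive (+-identityʳ 1#) ⟩
        1# ∎
        where open SemiringSum semiring using (*-distribˡ-sum; sum-cong-≋)

      -- Modulo `w` only the leading coefficient of `p` survives, and the normalisation of `P̄`
      -- divides it away.
      P̄∼1 : P̄ p w ∼ 1#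
      P̄∼1 = begin
        w ^ ℓ * P p (w ⁻¹) * p (fromℕ ℓ) ⁻¹
          ≈⟨ *-congʳ-∼ (p⁻¹∈ (fromℕ ℓ)) (y^ℓP⁻¹∼reversal w≉0 w∈) ⟩
        reversal p w * p (fromℕ ℓ) ⁻¹
          ≈⟨ *-congʳ-∼ (p⁻¹∈ (fromℕ ℓ)) (reversal∼leading w∈ p p∈) ⟩
        p (fromℕ ℓ) * p (fromℕ ℓ) ⁻¹
          ≈⟨ ∼-reflexive (⁻¹-inverseʳ (p≉0 (fromℕ ℓ))) ⟩
        1# ∎

      -- `reversal p y` is reached in two ways: from `y ⁻¹`, which gives `P̄ p y`, and from `x`,
      -- which gives a multiple of `P p x`.
      P̄-next : ∀ {x y} → ¬ (y ≈ 0#) → A y → A x → x * y ∼ 1# →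
               P p x ∼ 0# → P̄ p y ∼ 0#
      P̄-next {x} {y} y≉0 y∈ x∈ xy∼1 Px∼0 = begin
        y ^ ℓ * P p (y ⁻¹) * p (fromℕ ℓ) ⁻¹
          ≈⟨ *-congʳ-∼ (p⁻¹∈ (fromℕ ℓ)) (y^ℓP⁻¹∼reversal y≉0 y∈) ⟩
        reversal p y * p (fromℕ ℓ) ⁻¹
          ≈⟨ *-congʳ-∼ (p⁻¹∈ (fromℕ ℓ)) (y^ℓP∼reversal y∈ (*∈ x∈ y∈) xy∼1) ⟨
        y ^ ℓ * P p x * p (fromℕ ℓ) ⁻¹
          ≈⟨ *-congʳ-∼ (p⁻¹∈ (fromℕ ℓ)) (*-congˡ-∼ (^∈ y∈ ℓ) Px∼0) ⟩
        y ^ ℓ * 0# * p (fromℕ ℓ) ⁻¹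
          ≈⟨ ∼-reflexive (trans (*-congʳ (zeroʳ _)) (zeroˡ _)) ⟩
        0# ∎

      -- `P p y` has no power of `x` in front, so `(y * x) ^ ℓ ∼ 1#` is inserted; its factor `x ^ ℓ`
      -- turns `P p y` into `reversal p x`.
      P-next : ∀ {x y} → ¬ (x ≈ 0#) → A y → A x → x * y ∼ 1# →
               P̄ p x ∼ 0# → P p y ∼ 0#
      P-next {x} {y} x≉0 y∈ x∈ xy∼1 P̄x∼0 = begin
        P p y
          ≈⟨ ∼-reflexive (*-identityˡ _) ⟨
        1# * P p y
          ≈⟨ *-congʳ-∼ (P∈ y∈) (^∼1 (*∈ y∈ x∈) yx∼1 ℓ) ⟨
        (y * x) ^ ℓ * P p y
          ≈⟨ ∼-reflexive (trans
               (*-congʳ (CommutativeExponentiation.^-distrib-* commutativeSemiring y x ℓ))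
               (*-assoc _ _ _)) ⟩
        y ^ ℓ * (x ^ ℓ * P p y)
          ≈⟨ *-congˡ-∼ (^∈ y∈ ℓ) (y^ℓP∼reversal x∈ (*∈ y∈ x∈) yx∼1) ⟩
        y ^ ℓ * reversal p x
          ≈⟨ *-congˡ-∼ (^∈ y∈ ℓ) (y^ℓP⁻¹∼reversal x≉0 x∈) ⟨
        y ^ ℓ * (x ^ ℓ * P p (x ⁻¹))
          -- Multiplying by the leading coefficient undoes the normalisation in `P̄ p x`.
          ≈⟨ ∼-reflexive (*-congˡ (sym (trans (*-assoc _ _ _)
               (trans (*-congˡ (⁻¹-inverseˡ (p≉0 (fromℕ ℓ)))) (*-identityʳ _))))) ⟩
        y ^ ℓ * (P̄ p x * p (fromℕ ℓ))
          ≈⟨ *-congˡ-∼ (^∈ y∈ ℓ) (*-congʳ-∼ (p∈ (fromℕ ℓ)) P̄x∼0) ⟩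
        y ^ ℓ * (0# * p (fromℕ ℓ))
          ≈⟨ ∼-reflexive (trans (*-congˡ (zeroˡ _)) (zeroʳ _)) ⟩
        0# ∎
        where
        yx∼1 : y * x ∼ 1#
        yx∼1 = ∼-trans (∼-reflexive (*-comm y x)) xy∼1

    Reciprocal-∼1 : ∀ {Q Q′} → Reciprocal Q Q′ → Q w ∼ 1#
    Reciprocal-∼1 (P-P̄ p c) = P∼1 c
    Reciprocal-∼1 (P̄-P p c) = P̄∼1 c

    Reciprocal-∼0 : ∀ {Q Q′ x y} → Reciprocal Q Q′ → ¬ (x ≈ 0#) → ¬ (y ≈ 0#) →
                    A x → A y → x * y ∼ 1# → Q x ∼ 0# → Q′ y ∼ 0#
    Reciprocal-∼0 (P-P̄ p c) x≉0 y≉0 x∈ y∈ = P̄-next c y≉0 y∈ x∈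
    Reciprocal-∼0 (P̄-P p c) x≉0 y≉0 x∈ y∈ = P-next c x≉0 y∈ x∈

    -- The terms `a`, `x`, `w`, `y`, `b` are consecutive in the sequence, read in either direction.
    next∈ : ∀ {Q Q′ R R′ a x y b} → Reciprocal Q Q′ → Reciprocal R R′ →
            ¬ (x ≈ 0#) → ¬ (y ≈ 0#) → A a → A x → A y →
            w * a ≈ Q x → x * y ≈ R w → w * b ≈ Q′ y → A b
    next∈ {a = a} Q-Q′ R-R′ x≉0 y≉0 a∈ x∈ y∈ wa≈Qx xy≈Rw wb≈Q′y =
      multiple∼0⇒∈ (∼-trans (∼-reflexive wb≈Q′y)
        (Reciprocal-∼0 Q-Q′ x≉0 y≉0 x∈ y∈
          (∼-trans (∼-reflexive xy≈Rw) (Reciprocal-∼1 R-R′))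
          (multiple∼0 a∈ (sym wa≈Qx))))

  -- Propagation of windows along the sequence

  byResidue : ℕ → Carrier → Carrier
  byResidue 1 = P p₁
  byResidue 2 = P p₂
  byResidue 3 = P̄ p₁
  byResidue _ = P̄ p₂

  -- `byResidue` copies the local function of `exchangePolynomial` under a name that lemmas can
  -- mention; the two agree only after the residue is split.
  exchangePolynomial≡byResidue : ∀ k → exchangePolynomial k ≡ byResidue (k %ℕ 4)
  exchangePolynomial≡byResidue k with k %ℕ 4
  ... | 0 = ≡.refl
  ... | 1 = ≡.refl
  ... | 2 = ≡.refl
  ... | 3 = ≡.refl
  ... | suc (suc (suc (suc _))) = ≡.refl

  module Windows
    (p₁-unit : UnitCoefficients p₁) (p₂-unit : UnitCoefficients p₂)
    (x≉0 : ∀ k → ¬ (x k ≈ 0#))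
    (exchange-relation : ∀ k → x (k ℤ.+ 1ℤ) * x (k ℤ.- 1ℤ) ≈ exchangePolynomial k (x k)) where

    private
      -- The residues of n and 4 + n agree definitionally; the base cases run down
      -- to -6 so that k and k + 2 have the same sign in the recursive calls.
      byResidue-reciprocal : ∀ k →
        Reciprocal (byResidue (k %ℕ 4)) (byResidue (ℤ.suc (ℤ.suc k) %ℕ 4))
      byResidue-reciprocal (+ 0) = P̄-P p₂ p₂-unit
      byResidue-reciprocal (+ 1) = P-P̄ p₁ p₁-unit
      byResidue-reciprocal (+ 2) = P-P̄ p₂ p₂-unit
      byResidue-reciprocal (+ 3) = P̄-P p₁ p₁-unit
      byResidue-reciprocal (+ suc (suc (suc (suc n)))) = byResidue-reciprocal (+ n)
      byResidue-reciprocal -[1+ 0 ] = P̄-P p₁ p₁-unit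
      byResidue-reciprocal -[1+ 1 ] = P-P̄ p₂ p₂-unit
      byResidue-reciprocal -[1+ 2 ] = P-P̄ p₁ p₁-unit
      byResidue-reciprocal -[1+ 3 ] = P̄-P p₂ p₂-unit
      byResidue-reciprocal -[1+ 4 ] = P̄-P p₁ p₁-unit
      byResidue-reciprocal -[1+ 5 ] = P-P̄ p₂ p₂-unit
      byResidue-reciprocal -[1+ suc (suc (suc (suc (suc (suc n))))) ] =
        byResidue-reciprocal -[1+ suc (suc n) ]

    -- Adding 2 swaps the residues 1 and 3, and 2 and 0 modulo 4.
    reciprocal : ∀ k → Reciprocal (exchangePolynomial k) (exchangePolynomial (ℤ.suc (ℤ.suc k)))
    reciprocal k = ≡.subst₂ Reciprocal
      (≡.sym (exchangePolynomial≡byResidue k))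
      (≡.sym (exchangePolynomial≡byResidue (ℤ.suc (ℤ.suc k))))
      (byResidue-reciprocal k)

    relation : ∀ j → x (ℤ.suc (ℤ.suc j)) * x j ≈ exchangePolynomial (ℤ.suc j) (x (ℤ.suc j))
    relation j = ≡.subst₂ (λ i h → x i * x h ≈ exchangePolynomial (ℤ.suc j) (x (ℤ.suc j)))
      (ℤₚ.+-comm (ℤ.suc j) 1ℤ)
      (≡.trans (ℤₚ.+-comm (ℤ.suc j) -1ℤ) (ℤₚ.pred-suc j))
      (exchange-relation (ℤ.suc j))

    relation′ : ∀ j → x j * x (ℤ.suc (ℤ.suc j)) ≈ exchangePolynomial (ℤ.suc j) (x (ℤ.suc j))
    relation′ j = trans (*-comm _ _) (relation j)

    Window : Pred Carrier 0ℓ → Pred ℤ 0ℓ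
    Window A j = A (x j) × A (x (ℤ.suc j)) × A (x (ℤ.suc (ℤ.suc j))) × A (x (ℤ.suc (ℤ.suc (ℤ.suc j))))

    window-up : ∀ S j → Window ℤ[ℙ][ S ] j → Window ℤ[ℙ][ S ] (ℤ.suc j)
    window-up S j (a∈ , x∈ , w∈ , y∈) = x∈ , w∈ , y∈ ,
      -- The modulus is the middle term `x j₂` of the five terms involved; the new term is
      -- `x (ℤ.suc j₃)`.
      next∈ (reciprocal j₁) (reciprocal j₂) (x≉0 j₁) (x≉0 j₃) a∈ x∈ y∈
        (relation j) (relation′ j₁) (relation′ j₂)
      where
      j₁ = ℤ.suc j
      j₂ = ℤ.suc j₁
      j₃ = ℤ.suc j₂
      open ModuloGenerator S (x≉0 j₂) w∈

    window-down : ∀ S j → Window ℤ[ℙ][ S ] (ℤ.suc j) → Window ℤ[ℙ][ S ] j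
    window-down S j (y∈ , w∈ , x∈ , a∈) =
      -- The same five terms read backwards, with the new term `x j`.
      next∈ (Reciprocal-sym (reciprocal j₁)) (reciprocal j₂) (x≉0 j₃) (x≉0 j₁) a∈ x∈ y∈
        (relation′ j₂) (relation j₁) (relation j)
      , y∈ , w∈ , x∈
      where
      j₁ = ℤ.suc j
      j₂ = ℤ.suc j₁
      j₃ = ℤ.suc j₂
      open ModuloGenerator S (x≉0 j₂) w∈

    x∈ : ∀ S j → Window ℤ[ℙ][ S ] j → ∀ k → ℤ[ℙ][ S ] (x k)
    x∈ S j window k with ℤ-induction (Window ℤ[ℙ][ S ]) (window-up S) (window-down S) j window k
    ... | xk∈ , _ = xk∈

    𝓐-generators : ∀ k →
      𝓐 ≐ ℤ[ℙ][ ｛ x (k - 1ℤ) ｝ ∪ ｛ x k ｝ ∪ ｛ x (k + 1ℤ) ｝ ∪ ｛ x (k + + 2) ｝ ]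
    𝓐-generators k =
        generated-⊆ (λ { (j , ≡.refl) → x∈ S (k - 1ℤ) window j })
      , generated-⊆ (λ where
          (inj₁ ≡.refl)               → generator (k - 1ℤ , ≡.refl)
          (inj₂ (inj₁ ≡.refl))        → generator (k , ≡.refl)
          (inj₂ (inj₂ (inj₁ ≡.refl))) → generator (k + 1ℤ , ≡.refl)
          (inj₂ (inj₂ (inj₂ ≡.refl))) → generator (k + + 2 , ≡.refl))
      where
      S : Pred Carrier 0ℓ
      S = ｛ x (k - 1ℤ) ｝ ∪ ｛ x k ｝ ∪ ｛ x (k + 1ℤ) ｝ ∪ ｛ x (k + + 2) ｝

      -- A window is indexed by iterated `ℤ.suc` from `k - 1ℤ`, the generators by offsets from `k`;
      -- these equations match the two.
      k-1+1 : k ≡ ℤ.suc (k - 1ℤ)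
      k-1+1 = ≡.sym (≡.trans (≡.cong ℤ.suc (ℤₚ.+-comm k -1ℤ)) (ℤₚ.suc-pred k))

      k+2 : k + + 2 ≡ ℤ.suc (ℤ.suc k)
      k+2 = ≡.trans (ℤₚ.+-comm k (+ 2)) (ℤₚ.+-assoc 1ℤ 1ℤ k)

      window : Window ℤ[ℙ][ S ] (k - 1ℤ)
      window =
          generator (inj₁ ≡.refl)
        , generator (inj₂ (inj₁ (≡.cong x k-1+1)))
        , generator (inj₂ (inj₂ (inj₁ (≡.cong x (≡.trans (ℤₚ.+-comm k 1ℤ) (≡.cong ℤ.suc k-1+1))))))
        , generator (inj₂ (inj₂ (inj₂ (≡.cong x
            (≡.trans k+2 (≡.cong ℤ.suc (≡.cong ℤ.suc k-1+1)))))))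

theoremA2 : (ℓ₁ ℓ₂ : ℕ) .{{_ : NonZero ℓ₁}} .{{_ : NonZero ℓ₂}} →
    let open ClusterAlgebra ℓ₁ ℓ₂ in
    (k : ℤ) →
    𝓐 ≐ ℤ[ℙ][ ｛ x (k - 1ℤ) ｝ ∪ ｛ x k ｝ ∪ ｛ x (k + 1ℤ) ｝ ∪ ｛ x (k + + 2) ｝ ]
theoremA2 ℓ₁ ℓ₂ = Windows.𝓐-generators
  -- `refl` suffices because `p₁ zero` and `p₂ zero` are `1#` by definition.
  (unitCoefficients refl p₁≉0 p₁^∈ℤ[ℙ]) (unitCoefficients refl p₂≉0 p₂^∈ℤ[ℙ])
  x≉0 exchange-relation
  where
  open ClusterAlgebra ℓ₁ ℓ₂
  open DiscreteField 𝓕 using (refl)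
  open GeneratedSubalgebra 𝓕 p₁ p₂ x₁ x₂
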